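{- (Completeness.) Let $\equiv$ be the equivalence on GKAT expressions generated by the GKAT axioms together with the uniqueness axiom. Then the axioms are complete with respect to $[\![-]\!]$: for all $e_1,e_2\in\mathrm{Exp}$, \[ [\![e_1]\!]=[\![e_2]\!]\quad\Longrightarrow\quad e_1\equiv e_2. \]
   Context: Syntax. Fix disjoint nonempty sets $\Sigma$ (actions) and $T$ (primitive tests), $T$ finite. Boolean expressions $b,c\in\mathrm{BExp}$ are generated by $0 \mid 1 \mid t\in T \mid b\cdot c \mid b+c \mid \overline{b}$. GKAT expressions $e,f,g\in\mathrm{Exp}$ are generated by $p\in\Sigma \mid b\in\mathrm{BExp} \mid e\cdot f \mid e+_b f \mid e^{(b)}$; $ef$ abbreviates $e\cdot f$. $\equiv_{BA}$ denotes Boolean equivalence, $b\le c$ iff $b+c\equiv_{BA}c$. $\mathrm{At}$ is the finite set of atoms (minimal nonzero elements) of the free Boolean algebra $\mathrm{BExp}/{\equiv_{BA}}$ on $T$. Language model. Guarded strings: $\mathrm{GS}=\mathrm{At}\cdot(\Sigma\cdot\mathrm{At})^*$. Fusion product: $x\alpha\diamond\beta y = x\alpha y$ if $\alpha=\beta$, undefined otherwise; for $L,K\subseteq\mathrm{GS}$, $L\diamond K=\{x\diamond y : x\in L,y\in K, x\diamond y\text{ defined}\}$; $L^0=\mathrm{At}$, $L^{n+1}=L^n\diamond L$. For $B\subseteq\mathrm{At}$, $\overline{B}=\mathrm{At}\setminus B$, $L+_BK=(B\diamond L)\cup(\overline{B}\diamond K)$, $L^{(B)}=\bigcup_{n\ge0}(B\diamond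 L)^n\diamond\overline{B}$. Then $[\![-]\!]:\mathrm{Exp}\to 2^{\mathrm{GS}}$ is: $[\![p]\!]=\{\alpha p\beta:\alpha,\beta\in\mathrm{At}\}$, $[\![b]\!]=\{\alpha\in\mathrm{At}:\alpha\le b\}$, $[\![e\cdot f]\!]=[\![e]\!]\diamond[\![f]\!]$, $[\![e+_bf]\!]=[\![e]\!]+_{[\![b]\!]}[\![f]\!]$, $[\![e^{(b)}]\!]=[\![e]\!]^{([\![b]\!])}$. Axioms. $E:\mathrm{Exp}\to\mathrm{BExp}$ is defined by $E(b)=b$, $E(p)=0$, $E(e+_bf)=b\cdot E(e)+\overline{b}\cdot E(f)$, $E(e\cdot f)=E(e)\cdot E(f)$, $E(e^{(b)})=\overline{b}$. The relation $\equiv$ is the smallest congruence (with respect to all operators) on $\mathrm{Exp}$ such that $b\equiv_{BA}c$ implies $b\equiv c$, such that for all $e,f,g\in\mathrm{Exp}$, $b,c\in\mathrm{BExp}$: (U1) $e+_be\equiv e$; (U2) $e+_bf\equiv f+_{\overline{b}}e$; (U3) $(e+_bf)+_cg\equiv e+_{bc}(f+_cg)$; (U4) $e+_bf\equiv be+_bf$; (U5) $eg+_bfg\equiv(e+_bf)\cdot g$; (S1) $(e\cdot f)\cdot g\equiv e\cdot(f\cdot g)$; (S2) $0\cdot e\equiv0$; (S3) $e\cdot0\equiv0$; (S4) $1\cdot e\equiv e$; (S5) $e\cdot1\equiv e$; (W1) $e^{(b)}\equiv ee^{(b)}+_b1$; (W2) $(e+_c1)^{(b)}\equiv(ce)^{(b)}$;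 (W3) if $g\equiv eg+_bf$ and $E(e)\equiv0$, then $g\equiv e^{(b)}f$; and which is closed under the uniqueness axiom: any Salomaa system of left-affine equations has at most one solution modulo $\equiv$, i.e. whenever $s,s'$ are solutions to a Salomaa system, $s(x_i)\equiv s'(x_i)$ for all $i$. Systems. A system of left-affine equations is a finite set of equations $x_i=e_{i1}x_1+_{b_{i1}}\cdots+_{b_{i(n-1)}}e_{in}x_n+_{b_{in}}d_i$ ($1\le i\le n$), where $+_b$ associates to the right, the $x_i$ are variables, $e_{ij}\in\mathrm{Exp}$, and $b_{ij},d_i\in\mathrm{BExp}$ satisfy, in each row $i$: $b_{ij}\cdot b_{ik}\equiv_{BA}0$ for all $j\ne k$, and $b_{ij}\cdot d_i\equiv_{BA}0$ for all $j$. It is Salomaa if $E(e_{ij})\equiv0$ for all $i,j$. A solution is a function $s:\{x_1,\dots,x_n\}\to\mathrm{Exp}$ with $s(x_i)\equiv e_{i1}\cdot s(x_1)+_{b_{i1}}\cdots+_{b_{i(n-1)}}e_{in}\cdot s(x_n)+_{b_{in}}d_i$ for all $i$. -}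

module Defs where

open import Level using (Level; _⊔_)
open import Algebra.Lattice.Bundles using (BooleanAlgebra)
open import Data.Fin.Base using (Fin)
open import Data.List.Base using (List; []; _∷_; _++_; foldl)
import Data.List.Relation.Binary.Pointwise as Pointwise
open import Data.Nat.Base using (ℕ; zero; suc)
open import Data.Product.Base using (Σ; _×_; _,_; proj₁; proj₂; ∃₂)
open import Data.Product.Relation.Binary.Pointwise.NonDependent using (_×ₛ_)
open import Data.Vec.Functional using (Vector; foldr)
open import Relation.Binary.Bundles using (Setoid)
open import Relation.Binary.Core using (Rel)
open import Relation.Binary.PropositionalEquality using (_≡_; _≢_; setoid)
open import Relation.Nullary.Negation using (¬_)
open import Relation.Unary using (Pred; U; ∁; _∪_; ⋃)
import Relation.Binary.Construct.On as On

module GKAT {a t : Level} (Act : Set a) (T : Set t) where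

  infix  4 _≡BA_ _≤BA_ _≈_
  infixl 6 _+_
  infixl 7 _·_ _⨾_ _⋄_
  infixr 6 _+⟨_⟩_ _+ᴸ⟨_⟩_
  infix  8 _^⟨_⟩ _^ᴸ⟨_⟩

  data BExp : Set t where
    𝟘 𝟙  : BExp
    prim : T → BExp
    _·_  : BExp → BExp → BExp
    _+_  : BExp → BExp → BExp
    ~_   : BExp → BExp

  -- The congruence generated by the axioms of Boolean algebra, so that
  -- BExp modulo _≡BA_ is the free Boolean algebra on T.
  data _≡BA_ : Rel BExp t where
    refl   : ∀ {b} → b ≡BA b
    sym    : ∀ {b c} → b ≡BA c → c ≡BA b
    trans  : ∀ {b c d} → b ≡BA c → c ≡BA d → b ≡BA d
    +-cong : ∀ {b b′ c c′} → b ≡BA b′ → c ≡BA c′ → b + c ≡BA b′ + c′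
    ·-cong : ∀ {b b′ c c′} → b ≡BA b′ → c ≡BA c′ → b · c ≡BA b′ · c′
    ~-cong : ∀ {b b′} → b ≡BA b′ → ~ b ≡BA ~ b′
    +-comm  : ∀ b c → b + c ≡BA c + b
    ·-comm  : ∀ b c → b · c ≡BA c · b
    +-assoc : ∀ b c d → (b + c) + d ≡BA b + (c + d)
    ·-assoc : ∀ b c d → (b · c) · d ≡BA b · (c · d)
    +-absorbs-·  : ∀ b c → b + b · c ≡BA b
    ·-absorbs-+  : ∀ b c → b · (b + c) ≡BA b
    +-distribˡ-· : ∀ b c d → b + c · d ≡BA (b + c) · (b + d)
    ·-distribˡ-+ : ∀ b c d → b · (c + d) ≡BA b · c + b · d
    +-complementʳ : ∀ b → b + ~ b ≡BA 𝟙
    ·-complementʳ : ∀ b → b · ~ b ≡BA 𝟘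

  BExp-booleanAlgebra : BooleanAlgebra t t
  BExp-booleanAlgebra = record
    { Carrier = BExp
    ; _≈_ = _≡BA_
    ; _∨_ = _+_
    ; _∧_ = _·_
    ; ¬_  = ~_
    ; ⊤   = 𝟙
    ; ⊥   = 𝟘
    ; isBooleanAlgebra = record
      { isDistributiveLattice = record
        { isLattice = record
          { isEquivalence = record { refl = refl ; sym = sym ; trans = trans }
          ; ∨-comm  = +-comm
          ; ∨-assoc = +-assoc
          ; ∨-cong  = +-cong
          ; ∧-comm  = ·-comm
          ; ∧-assoc = ·-assoc
          ; ∧-cong  = ·-cong
          ; absorptive = +-absorbs-· , ·-absorbs-+
          }
        ; ∨-distrib-∧ = +-distribˡ-· ,
            λ b c d → trans (+-comm (c · d) b)
                     (trans (+-distribˡ-· b c d) (·-cong (+-comm b c) (+-comm b d)))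
        ; ∧-distrib-∨ = ·-distribˡ-+ ,
            λ b c d → trans (·-comm (c + d) b)
                     (trans (·-distribˡ-+ b c d) (+-cong (·-comm b c) (·-comm b d)))
        }
      ; ∨-complement = (λ b → trans (+-comm (~ b) b) (+-complementʳ b)) , +-complementʳ
      ; ∧-complement = (λ b → trans (·-comm (~ b) b) (·-complementʳ b)) , ·-complementʳ
      ; ¬-cong = ~-cong
      }
    }

  _≤BA_ : Rel BExp t
  b ≤BA c = b + c ≡BA c

  record IsAtom (α : BExp) : Set t where
    field
      nonzero : ¬ (α ≡BA 𝟘)
      minimal : ∀ {b} → ¬ (b ≡BA 𝟘) → b ≤BA α → b ≡BA α

  -- Atoms are elements of the quotient of BExp by _≡BA_: two atoms are equal
  -- when their representatives are Boolean equivalent.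
  At : Set t
  At = Σ BExp IsAtom

  atSetoid : Setoid t t
  atSetoid = On.setoid (BooleanAlgebra.setoid BExp-booleanAlgebra) (proj₁ {B = IsAtom})

  open Setoid atSetoid public using () renaming (_≈_ to _≈ᴬ_)

  -- The inclusion of BExp in Exp is the constructor test; a product of two
  -- tests can thus be written in two ways, which the rule test-· below
  -- identifies.
  data Exp : Set (a ⊔ t) where
    act    : Act → Exp
    test   : BExp → Exp
    _⨾_    : Exp → Exp → Exp
    _+⟨_⟩_ : Exp → BExp → Exp → Exp
    _^⟨_⟩  : Exp → BExp → Exp

  GS : Set (a ⊔ t)
  GS = At × List (Act × At)

  gsSetoid : Setoid (a ⊔ t) (a ⊔ t)
  gsSetoid = atSetoid ×ₛ Pointwise.setoid (setoid Act ×ₛ atSetoid)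

  open Setoid gsSetoid public using () renaming (_≈_ to _≈ᴳ_)

  first : GS → At
  first (α , _) = α

  last : GS → At
  last (α , u) = foldl (λ _ (_ , β) → β) α u

  -- The fusion product x ⋄ y, meaningful only when last x ≈ᴬ first y.
  fuse : GS → GS → GS
  fuse (α , u) (_ , v) = α , u ++ v

  Language : Set _
  Language = Pred GS (a ⊔ t)

  _⋄_ : Language → Language → Language
  (L ⋄ K) z = ∃₂ λ x y → L x × K y × last x ≈ᴬ first y × z ≈ᴳ fuse x y

  -- A set of atoms viewed as a set of one-atom guarded strings.
  ⌊_⌋ : ∀ {ℓ} → Pred At ℓ → Pred GS (a ⊔ t ⊔ ℓ)
  ⌊ B ⌋ (α , u) = B α × u ≡ []

  _^ᴸ_ : Language → ℕ → Language
  L ^ᴸ zero  = ⌊ U ⌋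
  L ^ᴸ suc n = (L ^ᴸ n) ⋄ L

  _+ᴸ⟨_⟩_ : Language → Pred At t → Language → Language
  L +ᴸ⟨ B ⟩ K = (⌊ B ⌋ ⋄ L) ∪ (⌊ ∁ B ⌋ ⋄ K)

  _^ᴸ⟨_⟩ : Language → Pred At t → Language
  L ^ᴸ⟨ B ⟩ = ⋃ ℕ λ n → ((⌊ B ⌋ ⋄ L) ^ᴸ n) ⋄ ⌊ ∁ B ⌋

  ⟦_⟧ᴮ : BExp → Pred At t
  ⟦ b ⟧ᴮ (α , _) = α ≤BA b

  ⟦_⟧ : Exp → Language
  ⟦ act p ⟧ z    = ∃₂ λ α β → z ≈ᴳ (α , (p , β) ∷ [])
  ⟦ test b ⟧     = ⌊ ⟦ b ⟧ᴮ ⌋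
  ⟦ e ⨾ f ⟧      = ⟦ e ⟧ ⋄ ⟦ f ⟧
  ⟦ e +⟨ b ⟩ f ⟧ = ⟦ e ⟧ +ᴸ⟨ ⟦ b ⟧ᴮ ⟩ ⟦ f ⟧
  ⟦ e ^⟨ b ⟩ ⟧   = ⟦ e ⟧ ^ᴸ⟨ ⟦ b ⟧ᴮ ⟩

  E : Exp → BExp
  E (act p)      = 𝟘
  E (test b)     = b
  E (e ⨾ f)      = E e · E f
  E (e +⟨ b ⟩ f) = b · E e + ~ b · E f
  E (e ^⟨ b ⟩)   = ~ b

  record System (n : ℕ) : Set (a ⊔ t) where
    field
      coeff : Fin n → Fin n → Exp
      guard : Fin n → Fin n → BExp
      const : Fin n → BExp
      guard-disjoint : ∀ i {j k} → j ≢ k → guard i j · guard i k ≡BA 𝟘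
      const-disjoint : ∀ i j → guard i j · const i ≡BA 𝟘

    rhs : Vector Exp n → Fin n → Exp
    rhs s i = foldr (λ (e , b , x) r → e ⨾ x +⟨ b ⟩ r) (test (const i))
                    (λ j → coeff i j , guard i j , s j)

  -- These take the congruence as a parameter because the uniqueness rule
  -- uses them while the congruence is still being defined.
  IsSalomaa : ∀ {n} → Rel Exp (a ⊔ t) → System n → Set (a ⊔ t)
  IsSalomaa R S = ∀ i j → R (test (E (System.coeff S i j))) (test 𝟘)

  IsSolution : ∀ {n} → Rel Exp (a ⊔ t) → System n → Vector Exp n → Set (a ⊔ t)
  IsSolution R S s = ∀ i → R (s i) (System.rhs S s i)

  data _≈_ : Rel Exp (a ⊔ t) where
    refl  : ∀ {e} → e ≈ e
    sym   : ∀ {e f} → e ≈ f → f ≈ e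
    trans : ∀ {e f g} → e ≈ f → f ≈ g → e ≈ g

    -- Tests occurring inside tests and as guards are expressions too.
    test-+-cong : ∀ {b b′ c c′} → test b ≈ test b′ → test c ≈ test c′ →
                  test (b + c) ≈ test (b′ + c′)
    test-~-cong : ∀ {b b′} → test b ≈ test b′ → test (~ b) ≈ test (~ b′)
    ⨾-cong  : ∀ {e e′ f f′} → e ≈ e′ → f ≈ f′ → e ⨾ f ≈ e′ ⨾ f′
    +⟨⟩-cong : ∀ {e e′ b b′ f f′} → e ≈ e′ → test b ≈ test b′ → f ≈ f′ →
               e +⟨ b ⟩ f ≈ e′ +⟨ b′ ⟩ f′
    ^⟨⟩-cong : ∀ {e e′ b b′} → e ≈ e′ → test b ≈ test b′ → e ^⟨ b ⟩ ≈ e′ ^⟨ b′ ⟩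

    test-BA : ∀ {b c} → b ≡BA c → test b ≈ test c
    test-·  : ∀ b c → test b ⨾ test c ≈ test (b · c)

    U1 : ∀ e b → e +⟨ b ⟩ e ≈ e
    U2 : ∀ e b f → e +⟨ b ⟩ f ≈ f +⟨ ~ b ⟩ e
    U3 : ∀ e b f c g → (e +⟨ b ⟩ f) +⟨ c ⟩ g ≈ e +⟨ b · c ⟩ (f +⟨ c ⟩ g)
    U4 : ∀ e b f → e +⟨ b ⟩ f ≈ (test b ⨾ e) +⟨ b ⟩ f
    U5 : ∀ e b f g → (e ⨾ g) +⟨ b ⟩ (f ⨾ g) ≈ (e +⟨ b ⟩ f) ⨾ g

    S1 : ∀ e f g → (e ⨾ f) ⨾ g ≈ e ⨾ (f ⨾ g)
    S2 : ∀ e → test 𝟘 ⨾ e ≈ test 𝟘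
    S3 : ∀ e → e ⨾ test 𝟘 ≈ test 𝟘
    S4 : ∀ e → test 𝟙 ⨾ e ≈ e
    S5 : ∀ e → e ⨾ test 𝟙 ≈ e

    W1 : ∀ e b → e ^⟨ b ⟩ ≈ (e ⨾ e ^⟨ b ⟩) +⟨ b ⟩ test 𝟙
    W2 : ∀ e b c → (e +⟨ c ⟩ test 𝟙) ^⟨ b ⟩ ≈ (test c ⨾ e) ^⟨ b ⟩
    W3 : ∀ {e b f g} → g ≈ (e ⨾ g) +⟨ b ⟩ f → test (E e) ≈ test 𝟘 →
         g ≈ e ^⟨ b ⟩ ⨾ f

    unique : ∀ {n} (S : System n) → IsSalomaa _≈_ S →
             ∀ {s s′} → IsSolution _≈_ S s → IsSolution _≈_ S s′ →
             ∀ i → s i ≈ s′ i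

{-# OPTIONS --safe #-}
module Submission where

-- Two expressions are provably equal as soon as they are so after multiplication by
-- every atom.  Atom by atom, an expression rejects, accepts, or performs an action and
-- continues as one of its finitely many derivatives, provably and in the language
-- semantics alike, so it solves a finite Salomaa system.  Uniqueness makes every state
-- from which acceptance is unreachable equal to 0, by (S3).  Once transitions into such
-- states are removed, states with the same language have the same transitions up to
-- states with the same language.  Hence on the pairs of states reachable from the
-- given pair, the left and right components solve the same system, and uniqueness
-- identifies them.

open import Defs
open import Algebra.Lattice.Bundles using (BooleanAlgebra)
import Algebra.Lattice.Properties.BooleanAlgebra as BooleanAlgebraProperties
open import Data.Bool.Base using (Bool; true; false; _∧_; _∨_; not; if_then_else_)
import Data.Bool.Properties as Bool
open import Data.Fin.Base using (Fin; zero; suc; combine; remQuot)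
import Data.Fin.Properties as Fin
open import Data.Fin.Subset.Properties using (anySubset?)
open import Data.List.Base using (List; []; _∷_; _++_; map; allFin; lookup)
open import Data.List.Membership.Propositional using (_∈_)
open import Data.List.Membership.Propositional.Properties
  using (∈-map⁺; ∈-map⁻; ∈-++⁺ˡ; ∈-++⁺ʳ; ∈-++⁻; ∈-allFin; ∈-lookup)
open import Data.List.Properties using (++-assoc)
import Data.List.Relation.Binary.Pointwise as Pointwise
open Pointwise using ([]; _∷_)
open import Data.List.Relation.Unary.Any using (here; there; index)
open import Data.List.Relation.Unary.Any.Properties using (lookup-index)
open import Data.Nat.Base using (ℕ; zero; suc; _*_)
open import Data.Product.Base using (∃; ∃-syntax; _×_; _,_; proj₁; proj₂)
open import Data.Product.Relation.Binary.Pointwise.NonDependent using (_×ₛ_)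
open import Data.Sum.Base using (_⊎_; inj₁; inj₂)
import Data.Vec.Base as Vec
open Vec using (Vec; []; _∷_)
open import Data.Vec.Functional using (Vector; foldr)
open import Function.Base using (_∘_; id)
open import Function.Bundles using (_↔_; module Inverse)
open import Level using (Lift; lift; lower; _⊔_)
open import Relation.Binary.Bundles using (Setoid)
open import Relation.Binary.Construct.Closure.ReflexiveTransitive using (Star; ε; _◅_; _◅◅_)
open import Relation.Binary.Core using (Rel)
import Relation.Binary.Definitions as Binary
open import Relation.Binary.PropositionalEquality as ≡ using (_≡_; _≢_; refl; cong; cong₂; subst; subst₂)
import Relation.Binary.Reasoning.Setoid as SetoidReasoning
open import Relation.Nullary using (¬_; Dec; yes; no; contradiction; does)
open import Relation.Nullary.Decidable as Dec using (dec-true; dec-false; ¬?; _×-dec_; _⊎-dec_)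
open import Relation.Unary using (Pred; Decidable; ∁; _≐_)

-- Removing transitions is unavoidable: `act p ⨾ test 𝟘` and `test 𝟘` have the same language, yet
-- only the first performs an action, so equal languages alone do not force equal transitions. Two
-- further constraints shape the proof. Atoms are given by representatives modulo `_≡BA_`; they are
-- named by Boolean vectors instead, finitely many since `T` is finite, and a sum over all atoms
-- becomes a decision tree of guarded sums. Moreover, uniqueness speaks about all variables of a
-- system at once, while the equations at hand may hold for some states only. Confining it to a set
-- of states requires deciding membership, so the sets used are described by reachability in a
-- finite graph, not by emptiness or equality of languages, which quantify over all guarded strings.

module _ {n ℓ} {R : Rel (Fin n) ℓ} (R? : Binary.Decidable R) where

  -- As in Warshall's algorithm: paths whose intermediate vertices lie in a list.
  private
    Via : List (Fin n) → Rel (Fin n) ℓ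
    Via []       i j = Lift ℓ (i ≡ j) ⊎ R i j
    Via (k ∷ ks) i j = Via ks i j ⊎ (Via ks i k × Via ks k j)

    via? : ∀ ks → Binary.Decidable (Via ks)
    via? []       i j = Dec.map′ lift lower (i Fin.≟ j) ⊎-dec R? i j
    via? (k ∷ ks) i j = via? ks i j ⊎-dec (via? ks i k ×-dec via? ks k j)

    -- A walk never needs to visit the head vertex twice: what lies between two visits is a loop and
    -- is dropped.
    via-concat : ∀ {ks i j k} → k ∈ ks → Via ks i k → Via ks k j → Via ks i j
    via-concat (here refl) p q = inj₂ (prefix p , suffix q)
      where
      prefix : ∀ {ks i k} → Via (k ∷ ks) i k → Via ks i k
      prefix (inj₁ p)       = p
      prefix (inj₂ (p , _)) = p
      suffix : ∀ {ks j k} → Via (k ∷ ks) k j → Via ks k j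
      suffix (inj₁ q)       = q
      suffix (inj₂ (_ , q)) = q
    via-concat (there k∈) (inj₁ p)        (inj₁ q)        = inj₁ (via-concat k∈ p q)
    via-concat (there k∈) (inj₁ p)        (inj₂ (q , q′)) = inj₂ (via-concat k∈ p q , q′)
    via-concat (there k∈) (inj₂ (p , p′)) (inj₁ q)        = inj₂ (p , via-concat k∈ p′ q)
    via-concat (there k∈) (inj₂ (p , p′)) (inj₂ (q , q′)) = inj₂ (p , q′)

    via-[] : ∀ ks {i j} → Via [] i j → Via ks i j
    via-[] []       p = p
    via-[] (k ∷ ks) p = inj₁ (via-[] ks p)

    via⇒star : ∀ ks {i j} → Via ks i j → Star R i j
    via⇒star []       (inj₁ (lift refl)) = ε
    via⇒star []       (inj₂ r)           = r ◅ ε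
    via⇒star (k ∷ ks) (inj₁ p)           = via⇒star ks p
    via⇒star (k ∷ ks) (inj₂ (p , q))     = via⇒star ks p ◅◅ via⇒star ks q

    star⇒via : ∀ {i j} → Star R i j → Via (allFin n) i j
    star⇒via ε       = via-[] (allFin n) (inj₁ (lift refl))
    star⇒via (r ◅ s) = via-concat (∈-allFin _) (via-[] (allFin n) (inj₂ r)) (star⇒via s)

  star? : Binary.Decidable (Star R)
  star? i j = Dec.map′ (via⇒star (allFin n)) star⇒via (via? (allFin n) i j)

module Completeness {a t} (Act : Set a) (T : Set t) {k} (T↔Fin : T ↔ Fin k) where

  open GKAT Act T
  open Inverse T↔Fin using (to; from; strictlyInverseˡ; strictlyInverseʳ)
  private module B where
    open BooleanAlgebra BExp-booleanAlgebra public
    open BooleanAlgebraProperties BExp-booleanAlgebra public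

  private module ≡BA-Reasoning = SetoidReasoning B.setoid

  -- Valuations and atoms

  Valuation : Set
  Valuation = Vec Bool k

  eval : BExp → Valuation → Bool
  eval 𝟘 v        = false
  eval 𝟙 v        = true
  eval (prim x) v = Vec.lookup v (to x)
  eval (b · c) v  = eval b v ∧ eval c v
  eval (b + c) v  = eval b v ∨ eval c v
  eval (~ b) v    = not (eval b v)

  eval-cong : ∀ {b c} → b ≡BA c → ∀ v → eval b v ≡ eval c v
  eval-cong refl v = refl
  eval-cong (sym p) v = ≡.sym (eval-cong p v)
  eval-cong (trans p q) v = ≡.trans (eval-cong p v) (eval-cong q v)
  eval-cong (+-cong p q) v = cong₂ _∨_ (eval-cong p v) (eval-cong q v)
  eval-cong (·-cong p q) v = cong₂ _∧_ (eval-cong p v) (eval-cong q v)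
  eval-cong (~-cong p) v = cong not (eval-cong p v)
  eval-cong (+-comm b c) v = Bool.∨-comm (eval b v) (eval c v)
  eval-cong (·-comm b c) v = Bool.∧-comm (eval b v) (eval c v)
  eval-cong (+-assoc b c d) v = Bool.∨-assoc (eval b v) (eval c v) (eval d v)
  eval-cong (·-assoc b c d) v = Bool.∧-assoc (eval b v) (eval c v) (eval d v)
  eval-cong (+-absorbs-· b c) v = Bool.∨-abs-∧ (eval b v) (eval c v)
  eval-cong (·-absorbs-+ b c) v = Bool.∧-abs-∨ (eval b v) (eval c v)
  eval-cong (+-distribˡ-· b c d) v = Bool.∨-distribˡ-∧ (eval b v) (eval c v) (eval d v)
  eval-cong (·-distribˡ-+ b c d) v = Bool.∧-distribˡ-∨ (eval b v) (eval c v) (eval d v)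
  eval-cong (+-complementʳ b) v = Bool.∨-inverseʳ (eval b v)
  eval-cong (·-complementʳ b) v = Bool.∧-inverseʳ (eval b v)

  literal : T → Bool → BExp
  literal x true  = prim x
  literal x false = ~ prim x

  minterm : ∀ {m} → (Fin m → T) → Vec Bool m → BExp
  minterm xs []      = 𝟙
  minterm xs (y ∷ v) = literal (xs zero) y · minterm (xs ∘ suc) v

  atom : Valuation → BExp
  atom = minterm from

  infix 8 _∣_
  _∣_ : BExp → Bool → BExp
  b ∣ true  = b
  b ∣ false = 𝟘

  ∣-cong : ∀ {b c} y → b ≡BA c → b ∣ y ≡BA c ∣ y
  ∣-cong true p  = p
  ∣-cong false p = refl

  ·-∣ : ∀ b c y → b · c ∣ y ≡BA (b · c) ∣ y
  ·-∣ b c true  = refl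
  ·-∣ b c false = B.∧-zeroʳ b

  ∣-· : ∀ b c y → b ∣ y · c ≡BA (b · c) ∣ y
  ∣-· b c true  = refl
  ∣-· b c false = B.∧-zeroˡ c

  literal-· : ∀ x y → literal x y · prim x ≡BA literal x y ∣ y
  literal-· x true  = B.∧-idem (prim x)
  literal-· x false = B.∧-complementˡ (prim x)

  minterm-·-prim : ∀ {m} (xs : Fin m → T) v i →
                   minterm xs v · prim (xs i) ≡BA minterm xs v ∣ Vec.lookup v i
  minterm-·-prim xs (y ∷ v) zero = begin
    (l · r) · prim (xs zero)  ≈⟨ ·-assoc l r _ ⟩
    l · (r · prim (xs zero))  ≈⟨ ·-cong refl (·-comm r _) ⟩
    l · (prim (xs zero) · r)  ≈⟨ ·-assoc l _ r ⟨
    (l · prim (xs zero)) · r  ≈⟨ ·-cong (literal-· (xs zero) y) refl ⟩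
    l ∣ y · r                 ≈⟨ ∣-· l r y ⟩
    (l · r) ∣ y               ∎
    where
    open ≡BA-Reasoning
    l = literal (xs zero) y
    r = minterm (xs ∘ suc) v
  minterm-·-prim xs (y ∷ v) (suc i) =
    trans (·-assoc _ _ _)
   (trans (·-cong refl (minterm-·-prim (xs ∘ suc) v i)) (·-∣ _ _ (Vec.lookup v i)))

  -- An atom decides every test: it decides the primitive ones by its literals, and the connectives
  -- act on these decisions as on truth values.
  atom-· : ∀ v b → atom v · b ≡BA atom v ∣ eval b v
  atom-· v 𝟘 = B.∧-zeroʳ _
  atom-· v 𝟙 = B.∧-identityʳ _
  atom-· v (prim x) = subst (λ z → atom v · prim z ≡BA atom v ∣ Vec.lookup v (to x))
                            (strictlyInverseʳ x) (minterm-·-prim from v (to x))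
  atom-· v (b · c) =
    trans (sym (·-assoc _ b c))
   (trans (·-cong (atom-· v b) refl)
   (trans (∣-· _ c (eval b v))
   (trans (∣-cong (eval b v) (atom-· v c)) (lemma (eval b v) (eval c v)))))
    where
    lemma : ∀ y z → (atom v ∣ z) ∣ y ≡BA atom v ∣ (y ∧ z)
    lemma true z  = refl
    lemma false z = refl
  atom-· v (b + c) =
    trans (·-distribˡ-+ _ b c)
   (trans (+-cong (atom-· v b) (atom-· v c)) (lemma (eval b v) (eval c v)))
    where
    lemma : ∀ y z → atom v ∣ y + atom v ∣ z ≡BA atom v ∣ (y ∨ z)
    lemma true true   = B.∨-idem _
    lemma true false  = B.∨-identityʳ _
    lemma false z     = B.∨-identityˡ _
  atom-· v (~ b) = lemma (eval b v) (atom-· v b)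
    where
    open ≡BA-Reasoning
    lemma : ∀ y → atom v · b ≡BA atom v ∣ y → atom v · ~ b ≡BA atom v ∣ not y
    lemma true p = begin
      atom v · ~ b        ≈⟨ ·-cong (sym p) refl ⟩
      (atom v · b) · ~ b  ≈⟨ ·-assoc _ b (~ b) ⟩
      atom v · (b · ~ b)  ≈⟨ ·-cong refl (·-complementʳ b) ⟩
      atom v · 𝟘          ≈⟨ B.∧-zeroʳ _ ⟩
      𝟘                   ∎
    lemma false p = begin
      atom v · ~ b               ≈⟨ B.∨-identityˡ _ ⟨
      𝟘 + atom v · ~ b           ≈⟨ +-cong (sym p) refl ⟩
      atom v · b + atom v · ~ b  ≈⟨ ·-distribˡ-+ _ b (~ b) ⟨
      atom v · (b + ~ b)         ≈⟨ ·-cong refl (+-complementʳ b) ⟩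
      atom v · 𝟙                 ≈⟨ B.∧-identityʳ _ ⟩
      atom v                     ∎

  atom-·-true : ∀ {v b} → eval b v ≡ true → atom v · b ≡BA atom v
  atom-·-true {v} {b} p = subst (λ y → atom v · b ≡BA atom v ∣ y) p (atom-· v b)

  atom-·-false : ∀ {v b} → eval b v ≡ false → atom v · b ≡BA 𝟘
  atom-·-false {v} {b} p = subst (λ y → atom v · b ≡BA atom v ∣ y) p (atom-· v b)

  -- Shannon expansion: b is the sum of its restrictions to the first primitive test and to the
  -- complement, which peels off one literal at a time.
  minterm-ext : ∀ {m} (xs : Fin m → T) {b c} →
                (∀ v → minterm xs v · b ≡BA minterm xs v · c) → b ≡BA c
  minterm-ext {zero} xs p = trans (sym (B.∧-identityˡ _)) (trans (p []) (B.∧-identityˡ _))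
  minterm-ext {suc m} xs {b} {c} p = begin
    b                                              ≈⟨ split b ⟨
    literal x true · b + literal x false · b       ≈⟨ +-cong (half true) (half false) ⟩
    literal x true · c + literal x false · c       ≈⟨ split c ⟩
    c                                              ∎
    where
    open ≡BA-Reasoning
    x = xs zero
    swap : ∀ l r d → r · (l · d) ≡BA (l · r) · d
    swap l r d = trans (sym (·-assoc r l d)) (·-cong (·-comm r l) refl)
    half : ∀ y → literal x y · b ≡BA literal x y · c
    half y = minterm-ext (xs ∘ suc) λ v →
      trans (swap _ _ b) (trans (p (y ∷ v)) (sym (swap _ _ c)))
    split : ∀ d → prim x · d + ~ prim x · d ≡BA d
    split d = trans (sym (B.∧-distribʳ-∨ d _ _))
                    (trans (·-cong (+-complementʳ _) refl) (B.∧-identityˡ d))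

  -- Completeness of the Boolean axioms for truth tables. Side conditions on guards built later are
  -- thereby checked by computing at each valuation.
  eval-ext : ∀ {b c} → (∀ v → eval b v ≡ eval c v) → b ≡BA c
  eval-ext {b} {c} p = minterm-ext from λ v →
    trans (atom-· v b)
          (trans (B.reflexive (cong (atom v ∣_) (p v))) (sym (atom-· v c)))

  -- Here w is the whole valuation and stays fixed, while v is the part of it that concerns the
  -- tests `xs` still to be treated and shrinks in the induction.
  eval-minterm : ∀ {m} (xs : Fin m → T) w v → (∀ i → Vec.lookup w (to (xs i)) ≡ Vec.lookup v i) →
                 eval (minterm xs v) w ≡ true
  eval-minterm xs w [] p = refl
  eval-minterm xs w (y ∷ v) p
    rewrite eval-minterm (xs ∘ suc) w v (p ∘ suc) = ≡.trans (Bool.∧-identityʳ _) (lit y (p zero))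
    where
    lit : ∀ y → Vec.lookup w (to (xs zero)) ≡ y → eval (literal (xs zero) y) w ≡ true
    lit true q  = q
    lit false q = cong not q

  eval-atom : ∀ v → eval (atom v) v ≡ true
  eval-atom v = eval-minterm from v v λ i → cong (Vec.lookup v) (strictlyInverseˡ i)

  atom-isAtom : ∀ v → IsAtom (atom v)
  atom-isAtom v = record
    { nonzero = λ p → contradiction (≡.trans (≡.sym (eval-atom v)) (eval-cong p v)) λ ()
    -- Being below `atom v` makes b equal to `atom v · b`, which by `atom-·` is either `atom v` or
    -- 𝟘.
    ; minimal = λ {b} b≢𝟘 b≤α → minimal b b≢𝟘
        (trans (sym (trans (·-cong refl (sym b≤α)) (·-absorbs-+ b _))) (·-comm b _)) (atom-· v b)
    }
    where
    minimal : ∀ b → ¬ (b ≡BA 𝟘) → b ≡BA atom v · b → atom v · b ≡BA atom v ∣ eval b v → b ≡BA atom v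
    minimal b b≢𝟘 p q with eval b v
    ... | true  = trans p q
    ... | false = contradiction (trans p q) b≢𝟘

  toAt : Valuation → At
  toAt v = atom v , atom-isAtom v

  infix 4 _⊩_
  _⊩_ : Valuation → At → Set t
  v ⊩ α = proj₁ α ≡BA atom v

  -- The valuation is found by search: subsets of `Fin k` are Boolean vectors, so `anySubset?` tries
  -- all valuations, and an expression false under each of them would be 𝟘 by `eval-ext`.
  valuation : ∀ α → ∃ λ v → v ⊩ α
  valuation (b , isAtom) with anySubset? (λ v → eval b v Bool.≟ true)
  ... | yes (v , p) = v , sym (IsAtom.minimal isAtom (IsAtom.nonzero (atom-isAtom v))
        (trans (+-comm _ b) (trans (+-cong refl (trans (sym (atom-·-true p)) (·-comm _ b))) (+-absorbs-· b _))))
  ... | no ¬p = contradiction (eval-ext λ v → Bool.¬-not λ p → ¬p (v , p)) (IsAtom.nonzero isAtom)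

  ⟦⟧ᴮ⇒eval : ∀ {v} α b → v ⊩ α → ⟦ b ⟧ᴮ α → eval b v ≡ true
  ⟦⟧ᴮ⇒eval {v} α b v⊩α α≤b = begin
    eval b v                      ≡⟨ eval-cong α≤b v ⟨
    eval (proj₁ α) v ∨ eval b v   ≡⟨ cong (_∨ eval b v) (eval-cong v⊩α v) ⟩
    eval (atom v) v ∨ eval b v    ≡⟨ cong (_∨ eval b v) (eval-atom v) ⟩
    true                          ∎
    where open ≡.≡-Reasoning

  eval⇒⟦⟧ᴮ : ∀ {v} α b → v ⊩ α → eval b v ≡ true → ⟦ b ⟧ᴮ α
  eval⇒⟦⟧ᴮ α b v⊩α p =
    trans (+-comm _ b)
   (trans (+-cong refl (trans v⊩α (trans (sym (atom-·-true p)) (·-comm _ b)))) (+-absorbs-· b _))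

  -- Guarded sums

  ≈-setoid : Setoid _ _
  ≈-setoid = record { Carrier = Exp ; _≈_ = _≈_ ; isEquivalence = record { refl = refl ; sym = sym ; trans = trans } }

  private module ≈-Reasoning = SetoidReasoning ≈-setoid

  reflexive : ∀ {e f} → e ≡ f → e ≈ f
  reflexive refl = refl

  guard-congˡ : ∀ {b c e f} → b ≡BA c → e +⟨ b ⟩ f ≈ e +⟨ c ⟩ f
  guard-congˡ p = +⟨⟩-cong refl (test-BA p) refl

  ~-guard : ∀ b e f → e +⟨ ~ b ⟩ f ≈ f +⟨ b ⟩ e
  ~-guard b e f = trans (U2 e (~ b) f) (guard-congˡ (B.¬-involutive b))

  U4ʳ : ∀ e b f → e +⟨ b ⟩ f ≈ e +⟨ b ⟩ (test (~ b) ⨾ f)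
  U4ʳ e b f = trans (U2 e b f) (trans (U4 f (~ b) e) (~-guard b _ e))

  test-+⟨⟩-𝟘 : ∀ b → test b +⟨ b ⟩ test 𝟘 ≈ test b
  test-+⟨⟩-𝟘 b = begin
    test b +⟨ b ⟩ test 𝟘               ≈⟨ +⟨⟩-cong refl refl (test-BA (B.∧-complementˡ b)) ⟨
    test b +⟨ b ⟩ test (~ b · b)       ≈⟨ +⟨⟩-cong refl refl (test-· (~ b) b) ⟨
    test b +⟨ b ⟩ (test (~ b) ⨾ test b) ≈⟨ U4ʳ (test b) b (test b) ⟨
    test b +⟨ b ⟩ test b               ≈⟨ U1 (test b) b ⟩
    test b                             ∎
    where open ≈-Reasoning

  -- Turns restriction by a test into a guarded sum, to which (U3) applies. In the proof (U4) plants
  -- the test before e, so that (U5) can factor e out.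
  +⟨⟩-𝟘 : ∀ b e → e +⟨ b ⟩ test 𝟘 ≈ test b ⨾ e
  +⟨⟩-𝟘 b e = begin
    e +⟨ b ⟩ test 𝟘                      ≈⟨ U4 e b _ ⟩
    (test b ⨾ e) +⟨ b ⟩ test 𝟘           ≈⟨ +⟨⟩-cong refl refl (S2 e) ⟨
    (test b ⨾ e) +⟨ b ⟩ (test 𝟘 ⨾ e)     ≈⟨ U5 _ b _ e ⟩
    (test b +⟨ b ⟩ test 𝟘) ⨾ e           ≈⟨ ⨾-cong (test-+⟨⟩-𝟘 b) refl ⟩
    test b ⨾ e                           ∎
    where open ≈-Reasoning

  +⟨⟩-absorbʳ : ∀ b e f → e +⟨ b ⟩ (f +⟨ b ⟩ test 𝟘) ≈ e +⟨ b ⟩ test 𝟘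
  +⟨⟩-absorbʳ b e f = begin
    e +⟨ b ⟩ (f +⟨ b ⟩ test 𝟘)              ≈⟨ U4ʳ e b _ ⟩
    e +⟨ b ⟩ (test (~ b) ⨾ (f +⟨ b ⟩ test 𝟘)) ≈⟨ +⟨⟩-cong refl refl vanish ⟩
    e +⟨ b ⟩ test 𝟘                          ∎
    where
    open ≈-Reasoning
    vanish : test (~ b) ⨾ (f +⟨ b ⟩ test 𝟘) ≈ test 𝟘
    vanish = begin
      test (~ b) ⨾ (f +⟨ b ⟩ test 𝟘)   ≈⟨ ⨾-cong refl (+⟨⟩-𝟘 b f) ⟩
      test (~ b) ⨾ (test b ⨾ f)        ≈⟨ S1 _ _ f ⟨
      (test (~ b) ⨾ test b) ⨾ f        ≈⟨ ⨾-cong (trans (test-· _ b) (test-BA (B.∧-complementˡ b))) refl ⟩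
      test 𝟘 ⨾ f                       ≈⟨ S2 f ⟩
      test 𝟘                           ∎

  -- With the restriction to c written as a guarded sum, (U3) merges the guards b and c into c. The
  -- branch f is then left with contradictory guards and vanishes.
  ≤-selectˡ : ∀ {c b} → c · b ≡BA c → ∀ e f → test c ⨾ (e +⟨ b ⟩ f) ≈ test c ⨾ e
  ≤-selectˡ {c} {b} c≤b e f = begin
    test c ⨾ (e +⟨ b ⟩ f)               ≈⟨ +⟨⟩-𝟘 c _ ⟨
    (e +⟨ b ⟩ f) +⟨ c ⟩ test 𝟘           ≈⟨ U3 e b f c _ ⟩
    e +⟨ b · c ⟩ (f +⟨ c ⟩ test 𝟘)       ≈⟨ guard-congˡ (trans (·-comm b c) c≤b) ⟩
    e +⟨ c ⟩ (f +⟨ c ⟩ test 𝟘)           ≈⟨ +⟨⟩-absorbʳ c e f ⟩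
    e +⟨ c ⟩ test 𝟘                      ≈⟨ +⟨⟩-𝟘 c e ⟩
    test c ⨾ e                          ∎
    where open ≈-Reasoning

  infix 4 _⊢_≈_
  -- Equality at a single atom. It is compatible with multiplication on the right only: after a
  -- prefix has acted, the atom may be a different one.
  _⊢_≈_ : Valuation → Exp → Exp → Set (a ⊔ t)
  v ⊢ e ≈ f = test (atom v) ⨾ e ≈ test (atom v) ⨾ f

  ⊢-⨾-congˡ : ∀ {v e f} g → v ⊢ e ≈ f → v ⊢ e ⨾ g ≈ f ⨾ g
  ⊢-⨾-congˡ g p = trans (sym (S1 _ _ g)) (trans (⨾-cong p refl) (S1 _ _ g))

  ⊢-cong : ∀ {v e f} → e ≈ f → v ⊢ e ≈ f
  ⊢-cong = ⨾-cong refl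

  ⊢-guard : ∀ v e b f → v ⊢ e +⟨ b ⟩ f ≈ (if eval b v then e else f)
  ⊢-guard v e b f with eval b v in eq
  ... | true  = ≤-selectˡ (atom-·-true eq) e f
  ... | false = trans (⊢-cong (U2 e b f)) (≤-selectˡ (atom-·-true (cong not eq)) f e)

  ⊢-test : ∀ v b → v ⊢ test b ≈ test (if eval b v then 𝟙 else 𝟘)
  ⊢-test v b = trans (test-· _ b) (trans (test-BA lemma) (sym (test-· _ _)))
    where
    lemma : atom v · b ≡BA atom v · (if eval b v then 𝟙 else 𝟘)
    lemma with eval b v in eq
    ... | true  = trans (atom-·-true eq) (sym (B.∧-identityʳ _))
    ... | false = trans (atom-·-false eq) (sym (B.∧-zeroʳ _))

  -- The expansion of `minterm-ext` again, with a guarded sum in place of the Boolean one: (U1)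
  -- splits an expression in two and (U4) puts the literals before the branches.
  minterm-≈-ext : ∀ {m} (xs : Fin m → T) {e f} →
                  (∀ v → test (minterm xs v) ⨾ e ≈ test (minterm xs v) ⨾ f) → e ≈ f
  minterm-≈-ext {zero} xs p = trans (sym (S4 _)) (trans (p []) (S4 _))
  minterm-≈-ext {suc m} xs {e} {f} p = begin
    e                                                ≈⟨ split e ⟨
    (test (prim x) ⨾ e) +⟨ prim x ⟩ (test (~ prim x) ⨾ e)  ≈⟨ +⟨⟩-cong (half true) refl (half false) ⟩
    (test (prim x) ⨾ f) +⟨ prim x ⟩ (test (~ prim x) ⨾ f)  ≈⟨ split f ⟩
    f                                                ∎
    where
    open ≈-Reasoning
    x = xs zero
    swap : ∀ l r g → test r ⨾ (test l ⨾ g) ≈ test (l · r) ⨾ g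
    swap l r g = trans (sym (S1 _ _ g))
                       (⨾-cong (trans (test-· r l) (test-BA (·-comm r l))) refl)
    half : ∀ y → test (literal x y) ⨾ e ≈ test (literal x y) ⨾ f
    half y = minterm-≈-ext (xs ∘ suc) λ v →
      trans (swap _ _ e) (trans (p (y ∷ v)) (sym (swap _ _ f)))
    split : ∀ g → (test (prim x) ⨾ g) +⟨ prim x ⟩ (test (~ prim x) ⨾ g) ≈ g
    split g = trans (sym (U4 g _ _)) (trans (sym (U4ʳ g _ g)) (U1 g _))

  ⊢-ext : ∀ {e f} → (∀ v → v ⊢ e ≈ f) → e ≈ f
  ⊢-ext = minterm-≈-ext from

  -- A complete decision tree asking the primitive tests in turn. It replaces a sum over all atoms:
  -- at each atom exactly one leaf survives.
  tree : ∀ {m} → (Fin m → T) → (Vec Bool m → Exp) → Exp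
  tree {zero}  xs f = f []
  tree {suc m} xs f = tree (xs ∘ suc) (f ∘ (true ∷_)) +⟨ prim (xs zero) ⟩
                      tree (xs ∘ suc) (f ∘ (false ∷_))

  ⊢-tree : ∀ {m} (xs : Fin m → T) w v → (∀ i → Vec.lookup w (to (xs i)) ≡ Vec.lookup v i) →
           ∀ f → w ⊢ tree xs f ≈ f v
  ⊢-tree xs w [] p f = refl
  ⊢-tree xs w (y ∷ v) p f = trans (⊢-guard w _ _ _) (lemma y (p zero))
    where
    lemma : ∀ y → Vec.lookup w (to (xs zero)) ≡ y →
            w ⊢ (if Vec.lookup w (to (xs zero)) then tree (xs ∘ suc) (f ∘ (true ∷_))
                 else tree (xs ∘ suc) (f ∘ (false ∷_))) ≈ f (y ∷ v)
    lemma true q rewrite q  = ⊢-tree (xs ∘ suc) w v (p ∘ suc) (f ∘ (true ∷_))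
    lemma false q rewrite q = ⊢-tree (xs ∘ suc) w v (p ∘ suc) (f ∘ (false ∷_))

  eval-E-tree : ∀ {m} (xs : Fin m → T) w v → (∀ i → Vec.lookup w (to (xs i)) ≡ Vec.lookup v i) →
                ∀ f → eval (E (tree xs f)) w ≡ eval (E (f v)) w
  eval-E-tree xs w [] p f = refl
  eval-E-tree xs w (y ∷ v) p f = lemma y (p zero)
    where
    lemma : ∀ y → Vec.lookup w (to (xs zero)) ≡ y →
            eval (E (tree xs f)) w ≡ eval (E (f (y ∷ v))) w
    lemma true q rewrite q  = ≡.trans (Bool.∨-identityʳ _) (eval-E-tree (xs ∘ suc) w v (p ∘ suc) (f ∘ (true ∷_)))
    lemma false q rewrite q = eval-E-tree (xs ∘ suc) w v (p ∘ suc) (f ∘ (false ∷_))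

  sum : (Valuation → Exp) → Exp
  sum = tree from

  lookup-from : ∀ (v : Valuation) i → Vec.lookup v (to (from i)) ≡ Vec.lookup v i
  lookup-from v i = cong (Vec.lookup v) (strictlyInverseˡ i)

  ⊢-sum : ∀ v f → v ⊢ sum f ≈ f v
  ⊢-sum v = ⊢-tree from v v (lookup-from v)

  eval-E-sum : ∀ v f → eval (E (sum f)) v ≡ eval (E (f v)) v
  eval-E-sum v = eval-E-tree from v v (lookup-from v)

  -- A Boolean expression with a prescribed truth table.
  holds : (Valuation → Bool) → BExp
  holds φ = E (sum λ v → test (if φ v then 𝟙 else 𝟘))

  eval-holds : ∀ φ v → eval (holds φ) v ≡ φ v
  eval-holds φ v = ≡.trans (eval-E-sum v _) (lemma (φ v))
    where
    lemma : ∀ y → eval (if y then 𝟙 else 𝟘) v ≡ y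
    lemma true  = refl
    lemma false = refl

  -- Derivatives

  -- The functor 2 + Σ × X of GKAT automata: an automaton assigns an outcome to each state and atom.
  data Outcome {x} (X : Set x) : Set (a ⊔ x) where
    reject accept : Outcome X
    step          : Act → X → Outcome X

  isAccept : ∀ {x} {X : Set x} → Outcome X → Bool
  isAccept accept = true
  isAccept _      = false

  out : ∀ {x} {X : Set x} → (X → Exp) → Outcome X → Exp
  out s reject     = test 𝟘
  out s accept     = test 𝟙
  out s (step p x) = act p ⨾ s x

  extend : Outcome Exp → Outcome Exp → Exp → Outcome Exp
  extend reject     o f = reject
  extend accept     o f = o
  extend (step p e) o f = step p (e ⨾ f)

  derivative : Exp → Valuation → Outcome Exp
  derivative (act p) v      = step p (test 𝟙)
  derivative (test b) v     = if eval b v then accept else reject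
  derivative (e ⨾ f) v      = extend (derivative e v) (derivative f v) f
  derivative (e +⟨ b ⟩ f) v = if eval b v then derivative e v else derivative f v
  -- A body that accepts at v would return to the same atom, with the guard still true, and never
  -- leave the loop; hence `reject`.
  derivative (e ^⟨ b ⟩) v   = if eval b v then extend (derivative e v) reject (e ^⟨ b ⟩) else accept

  -- The equation for f is required only if e accepts. In the case of a loop, f is the loop itself,
  -- and it is known to vanish at v only when the body accepts there.
  ⊢-extend : ∀ {v e o} f {o′} → v ⊢ e ≈ out id o → (o ≡ accept → v ⊢ f ≈ out id o′) →
             v ⊢ e ⨾ f ≈ out id (extend o o′ f)
  ⊢-extend {v} {e} {o} f p q = trans (⊢-⨾-congˡ f p) (lemma o q)
    where
    lemma : ∀ o {o′} → (o ≡ accept → v ⊢ f ≈ out id o′) →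
            v ⊢ out id o ⨾ f ≈ out id (extend o o′ f)
    lemma reject q     = ⊢-cong (S2 f)
    lemma accept q     = trans (⊢-cong (S4 f)) (q refl)
    lemma (step p e) q = ⊢-cong (S1 _ e f)

  -- Iterations of the body that perform no action are discarded by W2.
  ⊢-loop-accept : ∀ {v e b} → (∀ w → w ⊢ e ≈ out id (derivative e w)) → eval b v ≡ true →
                  derivative e v ≡ accept → v ⊢ e ^⟨ b ⟩ ≈ test 𝟘
  ⊢-loop-accept {v} {e} {b} fundamental p q = begin
    test (atom v) ⨾ (e ^⟨ b ⟩)               ≈⟨ ⊢-cong (^⟨⟩-cong (⊢-ext productive) refl) ⟩
    test (atom v) ⨾ ((e +⟨ c ⟩ test 𝟙) ^⟨ b ⟩) ≈⟨ ⊢-cong (W2 e b c) ⟩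
    test (atom v) ⨾ l                         ≈⟨ ⊢-cong (W1 (test c ⨾ e) b) ⟩
    test (atom v) ⨾ (((test c ⨾ e) ⨾ l) +⟨ b ⟩ test 𝟙) ≈⟨ ≤-selectˡ (atom-·-true p) _ _ ⟩
    test (atom v) ⨾ ((test c ⨾ e) ⨾ l)       ≈⟨ ⊢-⨾-congˡ l (⊢-⨾-congˡ e blocked) ⟩
    test (atom v) ⨾ ((test 𝟘 ⨾ e) ⨾ l)       ≈⟨ ⊢-cong (trans (S1 _ e l) (S2 _)) ⟩
    test (atom v) ⨾ test 𝟘                   ∎
    where
    open ≈-Reasoning
    -- The test c is true where e does not accept; elsewhere e equals 1, which gives the form that
    -- (W2) expects. Rewriting under the loop takes an equation at all atoms, although only v is of
    -- interest.
    c = ~ holds (isAccept ∘ derivative e)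
    l = (test c ⨾ e) ^⟨ b ⟩
    productive : ∀ w → w ⊢ e ≈ e +⟨ c ⟩ test 𝟙
    productive w = sym (trans (⊢-guard w e c _) (lemma (eval-holds (isAccept ∘ derivative e) w)))
      where
      lemma : eval (holds (isAccept ∘ derivative e)) w ≡ isAccept (derivative e w) →
              w ⊢ (if eval c w then e else test 𝟙) ≈ e
      lemma eq with derivative e w | fundamental w
      ... | reject   | r rewrite eq = refl
      ... | accept   | r rewrite eq = sym r
      ... | step _ _ | r rewrite eq = refl
    blocked : v ⊢ test c ≈ test 𝟘
    blocked = trans (⊢-test v c) (reflexive (cong (λ y → test (atom v) ⨾ test (if not y then 𝟙 else 𝟘))
      (≡.trans (eval-holds (isAccept ∘ derivative e) v) (cong isAccept q))))

  -- The fundamental theorem of GKAT, localised to one atom. The case of loops uses the induction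
  -- hypothesis for the body at every atom.
  ⊢-derivative : ∀ e v → v ⊢ e ≈ out id (derivative e v)
  ⊢-derivative (act p) v = ⊢-cong (sym (S5 _))
  ⊢-derivative (test b) v = trans (⊢-test v b) (lemma (eval b v))
    where
    lemma : ∀ y → v ⊢ test (if y then 𝟙 else 𝟘) ≈ out id (if y then accept else reject)
    lemma true  = refl
    lemma false = refl
  ⊢-derivative (e ⨾ f) v = ⊢-extend f (⊢-derivative e v) λ _ → ⊢-derivative f v
  ⊢-derivative (e +⟨ b ⟩ f) v = trans (⊢-guard v e b f) lemma
    where
    lemma : v ⊢ (if eval b v then e else f) ≈
            out id (if eval b v then derivative e v else derivative f v)
    lemma with eval b v
    ... | true  = ⊢-derivative e v
    ... | false = ⊢-derivative f v
  ⊢-derivative (e ^⟨ b ⟩) v = trans (⊢-cong (W1 e b)) (trans (⊢-guard v _ b _) lemma)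
    where
    lemma : v ⊢ (if eval b v then e ⨾ (e ^⟨ b ⟩) else test 𝟙) ≈
            out id (if eval b v then extend (derivative e v) reject (e ^⟨ b ⟩) else accept)
    lemma with eval b v in eq
    ... | true  = ⊢-extend _ (⊢-derivative e v) (⊢-loop-accept (⊢-derivative e) eq)
    ... | false = refl

  -- Languages

  private
    module Word = Setoid (Pointwise.setoid (≡.setoid Act ×ₛ atSetoid))
  open Word using () renaming (_≈_ to _≋_)

  -- Two words are compared in two pieces since the proof component of the first
  -- atom could not be inferred from an equation between words.
  record Extensional (L : Language) : Set (a ⊔ t) where
    constructor extensional
    field transport : ∀ {α β u w} → α ≈ᴬ β → u ≋ w → L (α , u) → L (β , w)
  open Extensional

  ⋄-extensional : ∀ L K → Extensional (L ⋄ K)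
  ⋄-extensional L K .transport α≈β u≋w (x , y , Lx , Ky , meet , eq , eqs) =
    x , y , Lx , Ky , meet , trans (sym α≈β) eq , Word.trans (Word.sym u≋w) eqs

  ⟦⟧ᴮ-resp : ∀ b {α β} → α ≈ᴬ β → ⟦ b ⟧ᴮ α → ⟦ b ⟧ᴮ β
  ⟦⟧ᴮ-resp b α≈β p = trans (+-cong (sym α≈β) refl) p

  ⟦⟧-extensional : ∀ e → Extensional ⟦ e ⟧
  ⟦⟧-extensional (act p) .transport α≈β u≋w (γ , δ , eq , eqs) =
    γ , δ , trans (sym α≈β) eq , Word.trans (Word.sym u≋w) eqs
  ⟦⟧-extensional (test b) .transport {α} {β} α≈β [] (p , refl) = ⟦⟧ᴮ-resp b {α} {β} α≈β p , refl
  ⟦⟧-extensional (e ⨾ f) = ⋄-extensional ⟦ e ⟧ ⟦ f ⟧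
  ⟦⟧-extensional (e +⟨ b ⟩ f) .transport α≈β u≋w (inj₁ (x , y , Lx , Ky , meet , eq , eqs)) =
    inj₁ (x , y , Lx , Ky , meet , trans (sym α≈β) eq , Word.trans (Word.sym u≋w) eqs)
  ⟦⟧-extensional (e +⟨ b ⟩ f) .transport α≈β u≋w (inj₂ (x , y , Lx , Ky , meet , eq , eqs)) =
    inj₂ (x , y , Lx , Ky , meet , trans (sym α≈β) eq , Word.trans (Word.sym u≋w) eqs)
  ⟦⟧-extensional (e ^⟨ b ⟩) .transport α≈β u≋w (n , x , y , Lx , Ky , meet , eq , eqs) =
    n , x , y , Lx , Ky , meet , trans (sym α≈β) eq , Word.trans (Word.sym u≋w) eqs

  after : At → Act → Language → Language
  after α p L (β , u) = L (α , (p , β) ∷ u)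

  ⋄-[]⁺ : ∀ {L K : Language} {α u} → L (α , []) → K (α , u) → (L ⋄ K) (α , u)
  ⋄-[]⁺ {α = α} {u} l k = (α , []) , (α , u) , l , k , refl , refl , Word.refl

  ⋄-∷⁺ : ∀ {L K : Language} {α p β u} → (after α p L ⋄ K) (β , u) → (L ⋄ K) (α , (p , β) ∷ u)
  ⋄-∷⁺ {α = α} {p} ((γ , w) , y , l , k , meet , β≈γ , eq) =
    (α , (p , γ) ∷ w) , y , l , k , meet , refl , (refl , β≈γ) ∷ eq

  -- Separates fusions by whether the left word is a single atom or supplies the first action.
  data Fusion (L K : Language) (α : At) : List (Act × At) → Set (a ⊔ t) where
    here  : ∀ {u} → L (α , []) → K (α , u) → Fusion L K α u
    there : ∀ {p β u} → (after α p L ⋄ K) (β , u) → Fusion L K α ((p , β) ∷ u)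

  ⋄⁻ : ∀ {L K : Language} → Extensional L → Extensional K →
       ∀ {α u} → (L ⋄ K) (α , u) → Fusion L K α u
  ⋄⁻ extL extK ((α′ , []) , (β , w) , l , k , meet , α≈α′ , eq) =
    here (transport extL (sym α≈α′) [] l) (transport extK (trans (sym meet) (sym α≈α′)) (Word.sym eq) k)
  ⋄⁻ extL extK ((α′ , (p , γ) ∷ w) , y , l , k , meet , α≈α′ , (refl , β≈γ) ∷ eq) =
    there ((γ , w) , y , transport extL (sym α≈α′) Word.refl l , k , meet , β≈γ , eq)

  ⌊⌋⋄⁻ : ∀ b α {L u} → Extensional L → (⌊ ⟦ b ⟧ᴮ ⌋ ⋄ L) (α , u) → ⟦ b ⟧ᴮ α × L (α , u)
  ⌊⌋⋄⁻ b α ext ((α′ , []) , (β , w) , (p , refl) , l , meet , eq , eqs) =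
    ⟦⟧ᴮ-resp b {α′} {α} (sym eq) p , transport ext (trans (sym meet) (sym eq)) (Word.sym eqs) l

  ∁⌊⌋⋄⁻ : ∀ b α {L u} → Extensional L → (⌊ ∁ ⟦ b ⟧ᴮ ⌋ ⋄ L) (α , u) → ¬ ⟦ b ⟧ᴮ α × L (α , u)
  ∁⌊⌋⋄⁻ b α ext ((α′ , []) , (β , w) , (p , refl) , l , meet , eq , eqs) =
    (λ q → p (⟦⟧ᴮ-resp b {α} {α′} eq q)) , transport ext (trans (sym meet) (sym eq)) (Word.sym eqs) l

  last-cong : ∀ {α β u w} → α ≈ᴬ β → u ≋ w → last (α , u) ≈ᴬ last (β , w)
  last-cong α≈β []             = α≈β
  last-cong α≈β ((_ , q) ∷ eq) = last-cong q eq

  last-fuse : ∀ α u {β} w → last (α , u) ≈ᴬ β → last (α , u ++ w) ≈ᴬ last (β , w)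
  last-fuse α []            w meet = last-cong meet (Word.refl {w})
  last-fuse α ((p , γ) ∷ u) w meet = last-fuse γ u w meet

  ⋄-assocʳ : ∀ {L M N : Language} z → ((L ⋄ M) ⋄ N) z → (L ⋄ (M ⋄ N)) z
  ⋄-assocʳ _ (xy , (ζ , w) , ((α , u) , (β , v) , l , m , meet , eq , eqs) , n , meet′ , eq′ , eqs′) =
    (α , u) , (β , v ++ w) , l ,
    ((β , v) , (ζ , w) , m , n ,
      trans (sym (last-fuse α u v meet)) (trans (sym (last-cong eq eqs)) meet′) , refl , Word.refl) ,
    meet , trans eq′ eq ,
    Word.trans eqs′ (Word.trans (Pointwise.++⁺ eqs Word.refl) (Word.reflexive (++-assoc u v w)))

  ⋄-assocˡ : ∀ {L M N : Language} z → (L ⋄ (M ⋄ N)) z → ((L ⋄ M) ⋄ N) z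
  ⋄-assocˡ _ ((α , u) , yz , l , ((β , v) , (ζ , w) , m , n , meet , eq , eqs) , meet′ , eq′ , eqs′) =
    (α , u ++ v) , (ζ , w) , ((α , u) , (β , v) , l , m , trans meet′ eq , refl , Word.refl) , n ,
    trans (last-fuse α u v (trans meet′ eq)) meet , eq′ ,
    Word.trans eqs′ (Word.trans (Pointwise.++⁺ (Word.refl {u}) eqs) (Word.reflexive (≡.sym (++-assoc u v w))))

  -- Powers nested to the right: the semantics appends factors on the right, whereas derivatives
  -- consume the first round.
  pow : Language → ℕ → Language → Language
  pow M zero    N = N
  pow M (suc n) N = M ⋄ pow M n N

  ⋄-monoʳ : ∀ {L M N : Language} → (∀ z → M z → N z) → ∀ z → (L ⋄ M) z → (L ⋄ N) z
  ⋄-monoʳ M⊆N z (x , y , l , m , meet , eq) = x , y , l , M⊆N y m , meet , eq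

  ⋄-monoˡ : ∀ {L M N : Language} → (∀ z → L z → M z) → ∀ z → (L ⋄ N) z → (M ⋄ N) z
  ⋄-monoˡ L⊆M z (x , y , l , m , meet , eq) = x , y , L⊆M x l , m , meet , eq

  pow-⋄ʳ : ∀ M n {N} z → pow M n (M ⋄ N) z → (M ⋄ pow M n N) z
  pow-⋄ʳ M zero    z p = p
  pow-⋄ʳ M (suc n) z p = ⋄-monoʳ (pow-⋄ʳ M n) z p

  pow-⋄ˡ : ∀ M n {N} z → (M ⋄ pow M n N) z → pow M n (M ⋄ N) z
  pow-⋄ˡ M zero    z p = p
  pow-⋄ˡ M (suc n) z p = ⋄-monoʳ (pow-⋄ˡ M n) z p

  ^-⋄⇒pow : ∀ M n {N} → Extensional N → ∀ z → ((M ^ᴸ n) ⋄ N) z → pow M n N z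
  ^-⋄⇒pow M zero extN (α , u) ((_ , []) , _ , _ , l , meet , eq , eqs) =
    transport extN (trans (sym meet) (sym eq)) (Word.sym eqs) l
  ^-⋄⇒pow M (suc n) {N} extN z p =
    pow-⋄ʳ M n z (^-⋄⇒pow M n (⋄-extensional M N) z (⋄-assocʳ z p))

  pow⇒^-⋄ : ∀ M n {N} z → pow M n N z → ((M ^ᴸ n) ⋄ N) z
  pow⇒^-⋄ M zero    (α , u) p = (α , []) , (α , u) , (_ , refl) , p , refl , refl , Word.refl
  pow⇒^-⋄ M (suc n) z       p = ⋄-assocˡ z (pow⇒^-⋄ M n z (pow-⋄ˡ M n z p))

  module _ {L : Language} (extL : Extensional L) (b : BExp) where
    private
      body exit : Language
      body = ⌊ ⟦ b ⟧ᴮ ⌋ ⋄ L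
      exit = ⌊ ∁ ⟦ b ⟧ᴮ ⌋

    iterate : ℕ → Language
    iterate n = pow body n exit

    exit-extensional : Extensional exit
    exit-extensional .transport {α} {β} α≈β [] (p , refl) = (λ q → p (⟦⟧ᴮ-resp b {β} {α} (sym α≈β) q)) , refl

    iterate-extensional : ∀ n → Extensional (iterate n)
    iterate-extensional zero             = exit-extensional
    iterate-extensional (suc n) = ⋄-extensional body (iterate n)

    loop⇒iterate : ∀ z → (L ^ᴸ⟨ ⟦ b ⟧ᴮ ⟩) z → ∃ λ n → iterate n z
    loop⇒iterate z (n , p) = n , ^-⋄⇒pow body n exit-extensional z p

    iterate⇒loop : ∀ n z → iterate n z → (L ^ᴸ⟨ ⟦ b ⟧ᴮ ⟩) z
    iterate⇒loop n z p = n , pow⇒^-⋄ body n z p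

    iterate-suc : ∀ n α {u} → iterate (suc n) (α , u) → ⟦ b ⟧ᴮ α × (L ⋄ iterate n) (α , u)
    iterate-suc n α p@((γ , w) , _ , q , _ , _ , eq , _) =
      ⟦⟧ᴮ-resp b {γ} {α} (sym eq) (proj₁ (⌊⌋⋄⁻ b γ {L} extL q)) ,
      ⋄-monoˡ (λ z q → proj₂ (⌊⌋⋄⁻ b (proj₁ z) {L} extL q)) (α , _) p

    loop-unfold : ∀ α {u} → ⟦ b ⟧ᴮ α → (L ⋄ (L ^ᴸ⟨ ⟦ b ⟧ᴮ ⟩)) (α , u) → (L ^ᴸ⟨ ⟦ b ⟧ᴮ ⟩) (α , u)
    loop-unfold α p ((γ , w) , y , l , m , meet , eq , eqs) with n , i ← loop⇒iterate y m =
      iterate⇒loop (suc n) (α , _) ((γ , w) , y ,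
        ((γ , []) , (γ , w) , (⟦⟧ᴮ-resp b {α} {γ} eq p , refl) , l , refl , refl , Word.refl) ,
        i , meet , eq , eqs)

  -- Semantic correctness of derivatives

  ∁⟦⟧ᴮ⇒eval : ∀ {v} α b → v ⊩ α → ¬ ⟦ b ⟧ᴮ α → eval b v ≡ false
  ∁⟦⟧ᴮ⇒eval α b v⊩α ¬p = Bool.¬-not λ q → ¬p (eval⇒⟦⟧ᴮ α b v⊩α q)

  -- The words that an outcome allows after its atom; the first atom of the guarded string is fixed
  -- beforehand and left out.
  data Match {x} {X : Set x} (s : X → Exp) : Outcome X → List (Act × At) → Set (a ⊔ t ⊔ x) where
    done : Match s accept []
    next : ∀ {p x β u} → ⟦ s x ⟧ (β , u) → Match s (step p x) ((p , β) ∷ u)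

  -- K need only be contained in the language of f: for a loop it is the set of words with n rounds
  -- left, which allows induction on n.
  match-⨾⁺ : ∀ {L K f o o′} α {u} → Extensional L → Extensional K → (∀ z → K z → ⟦ f ⟧ z) →
             (∀ {w} → L (α , w) → Match id o w) → (o ≡ accept → K (α , u) → Match id o′ u) →
             (L ⋄ K) (α , u) → Match id (extend o o′ f) u
  match-⨾⁺ {L} {K} α extL extK K⊆f mL mK lk with ⋄⁻ {L} {K} extL extK lk
  ... | here l k with mL l
  ...   | done = mK refl k
  match-⨾⁺ α extL extK K⊆f mL mK lk | there (x , y , l , k , meet , eq) with mL l
  ...   | next l′ = next (x , y , l′ , K⊆f y k , meet , eq)

  match-⨾⁻ : ∀ {L : Language} {f o o′} α {u} → (∀ {w} → Match id o w → L (α , w)) →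
             (Match id o′ u → ⟦ f ⟧ (α , u)) → Match id (extend o o′ f) u → (L ⋄ ⟦ f ⟧) (α , u)
  match-⨾⁻ {o = accept} α mL mf m = ⋄-[]⁺ (mL done) (mf m)
  match-⨾⁻ {L} {f} {o = step p e} α mL mf (next (x , y , l , k , meet , eq)) =
    ⋄-∷⁺ {L} {⟦ f ⟧} (x , y , mL (next l) , k , meet , eq)

  decide-guard : ∀ {v α} b → v ⊩ α → (⟦ b ⟧ᴮ α × eval b v ≡ true) ⊎ (¬ ⟦ b ⟧ᴮ α × eval b v ≡ false)
  decide-guard {v} {α} b v⊩α with eval b v in eq
  ... | true  = inj₁ (eval⇒⟦⟧ᴮ α b v⊩α eq , refl)
  ... | false = inj₂ ((λ p → contradiction (≡.trans (≡.sym (⟦⟧ᴮ⇒eval α b v⊩α p)) eq) λ ()) , refl)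

  derivative-⟦⟧⁺ : ∀ e {v} α {u} → v ⊩ α → ⟦ e ⟧ (α , u) → Match id (derivative e v) u
  -- The rounds are counted because a round without an action does not shorten the word; only the
  -- count decreases.
  iterate-match : ∀ e b n {v} α {u} → v ⊩ α → iterate (⟦⟧-extensional e) b n (α , u) →
                  Match id (derivative (e ^⟨ b ⟩) v) u

  derivative-⟦⟧⁺ (act p) α v⊩α (γ , δ , eq , (refl , _) ∷ []) = next (B.∨-zeroʳ _ , refl)
  derivative-⟦⟧⁺ (test b) {v} α v⊩α (p , refl)
    rewrite ⟦⟧ᴮ⇒eval {v} α b v⊩α p = done
  derivative-⟦⟧⁺ (e ⨾ f) α v⊩α =
    match-⨾⁺ {⟦ e ⟧} {⟦ f ⟧} α (⟦⟧-extensional e) (⟦⟧-extensional f) (λ _ p → p) (derivative-⟦⟧⁺ e α v⊩α)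
             (λ _ → derivative-⟦⟧⁺ f α v⊩α)
  derivative-⟦⟧⁺ (e +⟨ b ⟩ f) {v} α v⊩α (inj₁ p) with q , l ← ⌊⌋⋄⁻ b α {⟦ e ⟧} (⟦⟧-extensional e) p
    rewrite ⟦⟧ᴮ⇒eval {v} α b v⊩α q = derivative-⟦⟧⁺ e α v⊩α l
  derivative-⟦⟧⁺ (e +⟨ b ⟩ f) {v} α v⊩α (inj₂ p) with q , l ← ∁⌊⌋⋄⁻ b α {⟦ f ⟧} (⟦⟧-extensional f) p
    rewrite ∁⟦⟧ᴮ⇒eval {v} α b v⊩α q = derivative-⟦⟧⁺ f α v⊩α l
  derivative-⟦⟧⁺ (e ^⟨ b ⟩) α {u} v⊩α p with n , i ← loop⇒iterate (⟦⟧-extensional e) b (α , u) p =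
    iterate-match e b n α v⊩α i

  iterate-match e b zero {v} α v⊩α (p , refl) rewrite ∁⟦⟧ᴮ⇒eval {v} α b v⊩α p = done
  iterate-match e b (suc n) {v} α {u} v⊩α i with p , j ← iterate-suc (⟦⟧-extensional e) b n α i =
    subst (λ y → Match id (if y then extend (derivative e v) reject (e ^⟨ b ⟩) else accept) u) (≡.sym p′)
      (match-⨾⁺ {⟦ e ⟧} α (⟦⟧-extensional e) (iterate-extensional (⟦⟧-extensional e) b n)
         (iterate⇒loop (⟦⟧-extensional e) b n) (derivative-⟦⟧⁺ e α v⊩α)
         -- If the body accepts at once, the same word already arises in n rounds. By induction it
         -- matches the derivative of the loop, which the two equations reduce to `reject`.
         (λ q l → subst₂ (λ y o → Match id (if y then extend o reject (e ^⟨ b ⟩) else accept) u) p′ q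
                         (iterate-match e b n α v⊩α l)) j)
    where p′ = ⟦⟧ᴮ⇒eval {v} α b v⊩α p

  derivative-⟦⟧⁻ : ∀ e {v} α {u} → v ⊩ α → Match id (derivative e v) u → ⟦ e ⟧ (α , u)
  derivative-⟦⟧⁻ (act p) α v⊩α (next {β = β} (_ , refl)) = α , β , refl , Word.refl
  derivative-⟦⟧⁻ (test b) {v} α v⊩α m with decide-guard {v} {α} b v⊩α
  ... | inj₁ (p , eq) rewrite eq with done ← m = p , refl
  ... | inj₂ (_ , eq) rewrite eq with () ← m
  derivative-⟦⟧⁻ (e ⨾ f) α v⊩α = match-⨾⁻ {⟦ e ⟧} α (derivative-⟦⟧⁻ e α v⊩α) (derivative-⟦⟧⁻ f α v⊩α)
  derivative-⟦⟧⁻ (e +⟨ b ⟩ f) {v} α v⊩α m with decide-guard {v} {α} b v⊩α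
  ... | inj₁ (p , eq) rewrite eq = inj₁
    ((α , []) , (α , _) , (p , refl) , derivative-⟦⟧⁻ e α v⊩α m , refl , refl , Word.refl)
  ... | inj₂ (p , eq) rewrite eq = inj₂
    ((α , []) , (α , _) , (p , refl) , derivative-⟦⟧⁻ f α v⊩α m , refl , refl , Word.refl)
  derivative-⟦⟧⁻ (e ^⟨ b ⟩) {v} α v⊩α m with decide-guard {v} {α} b v⊩α
  ... | inj₁ (p , eq) rewrite eq =
    loop-unfold (⟦⟧-extensional e) b α p
      (match-⨾⁻ {⟦ e ⟧} {o = derivative e v} {o′ = reject} α (derivative-⟦⟧⁻ e α v⊩α) (λ ()) m)
  ... | inj₂ (p , eq) rewrite eq with done ← m = iterate⇒loop (⟦⟧-extensional e) b 0 (α , []) (p , refl)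

  -- Finite automata

  infix 4 _∈ᵒ_
  data _∈ᵒ_ {x} {X : Set x} (y : X) : Outcome X → Set (a ⊔ x) where
    target : ∀ {p} → y ∈ᵒ step p y

  ∈ᵒ-extend : ∀ o {o′ f y} → y ∈ᵒ extend o o′ f → (∃ λ e → e ∈ᵒ o × y ≡ e ⨾ f) ⊎ y ∈ᵒ o′
  ∈ᵒ-extend accept     y∈     = inj₂ y∈
  ∈ᵒ-extend (step p e) target = inj₁ (e , target , refl)

  -- A finite superset of the iterated derivatives, in the manner of Antimirov's partial
  -- derivatives: it only has to contain the expression and be closed.
  derivatives : Exp → List Exp
  derivatives (act p)      = act p ∷ test 𝟙 ∷ []
  derivatives (test b)     = test b ∷ []
  derivatives (e ⨾ f)      = map (_⨾ f) (derivatives e) ++ derivatives f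
  derivatives (e +⟨ b ⟩ f) = (e +⟨ b ⟩ f) ∷ derivatives e ++ derivatives f
  derivatives (e ^⟨ b ⟩)   = (e ^⟨ b ⟩) ∷ map (_⨾ (e ^⟨ b ⟩)) (derivatives e)

  self∈derivatives : ∀ e → e ∈ derivatives e
  self∈derivatives (act p)      = here refl
  self∈derivatives (test b)     = here refl
  self∈derivatives (e ⨾ f)      = ∈-++⁺ˡ (∈-map⁺ (_⨾ f) (self∈derivatives e))
  self∈derivatives (e +⟨ b ⟩ f) = here refl
  self∈derivatives (e ^⟨ b ⟩)   = here refl

  Closed : List Exp → Set _
  Closed xs = ∀ {e f} → e ∈ xs → ∀ v → f ∈ᵒ derivative e v → f ∈ xs

  ++-closed : ∀ {xs ys} → Closed xs → Closed ys → Closed (xs ++ ys)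
  ++-closed {xs} cxs cys e∈ v f∈ with ∈-++⁻ xs e∈
  ... | inj₁ e∈xs = ∈-++⁺ˡ (cxs e∈xs v f∈)
  ... | inj₂ e∈ys = ∈-++⁺ʳ xs (cys e∈ys v f∈)

  derivatives-closed : ∀ e → Closed (derivatives e)
  derivatives-closed (act p) (here refl) v target = there (here refl)
  derivatives-closed (act p) (there (here refl)) v ()
  derivatives-closed (test b) (here refl) v f∈ with eval b v
  derivatives-closed (test b) (here refl) v () | true
  derivatives-closed (test b) (here refl) v () | false
  derivatives-closed (e ⨾ f) x∈ v y∈ with ∈-++⁻ (map (_⨾ f) (derivatives e)) x∈
  ... | inj₂ x∈f = ∈-++⁺ʳ _ (derivatives-closed f x∈f v y∈)
  ... | inj₁ x∈ef with x , x∈e , refl ← ∈-map⁻ (_⨾ f) x∈ef with ∈ᵒ-extend (derivative x v) y∈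
  ...   | inj₁ (z , z∈ , refl) = ∈-++⁺ˡ (∈-map⁺ (_⨾ f) (derivatives-closed e x∈e v z∈))
  ...   | inj₂ y∈f             = ∈-++⁺ʳ _ (derivatives-closed f (self∈derivatives f) v y∈f)
  derivatives-closed (e +⟨ b ⟩ f) (there x∈) v y∈ =
    there (++-closed (derivatives-closed e) (derivatives-closed f) x∈ v y∈)
  derivatives-closed (e +⟨ b ⟩ f) (here refl) v y∈ with eval b v
  ... | true  = there (∈-++⁺ˡ (derivatives-closed e (self∈derivatives e) v y∈))
  ... | false = there (∈-++⁺ʳ _ (derivatives-closed f (self∈derivatives f) v y∈))
  derivatives-closed (e ^⟨ b ⟩) {f = y} x∈ v y∈ = there (lemma x∈ y∈)
    where
    loop : y ∈ᵒ derivative (e ^⟨ b ⟩) v → y ∈ map (_⨾ (e ^⟨ b ⟩)) (derivatives e)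
    loop y∈ with eval b v
    ... | true with inj₁ (z , z∈ , refl) ← ∈ᵒ-extend (derivative e v) y∈ =
      ∈-map⁺ _ (derivatives-closed e (self∈derivatives e) v z∈)
    lemma : ∀ {x} → x ∈ derivatives (e ^⟨ b ⟩) → y ∈ᵒ derivative x v →
            y ∈ map (_⨾ (e ^⟨ b ⟩)) (derivatives e)
    lemma (here refl) y∈ = loop y∈
    lemma (there x∈) y∈ with x , x∈e , refl ← ∈-map⁻ (_⨾ (e ^⟨ b ⟩)) x∈ with ∈ᵒ-extend (derivative x v) y∈
    ... | inj₁ (z , z∈ , refl) = ∈-map⁺ _ (derivatives-closed e x∈e v z∈)
    ... | inj₂ y∈l             = loop y∈l

  -- Provable and semantic transitions are bundled without reference to `derivative`, because
  -- pruning changes δ, keeps s and has to preserve both.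
  record Recognizes {n} (s : Fin n → Exp) (δ : Fin n → Valuation → Outcome (Fin n)) : Set (a ⊔ t) where
    field
      unfold : ∀ i v → v ⊢ s i ≈ out s (δ i v)
      word⁺  : ∀ i v α {u} → v ⊩ α → ⟦ s i ⟧ (α , u) → Match s (δ i v) u
      word⁻  : ∀ i v α {u} → v ⊩ α → Match s (δ i v) u → ⟦ s i ⟧ (α , u)
  open Recognizes

  mapᵒ : ∀ {x y} {X : Set x} {Y : Set y} → (X → Y) → Outcome X → Outcome Y
  mapᵒ g reject     = reject
  mapᵒ g accept     = accept
  mapᵒ g (step p x) = step p (g x)

  out-mapᵒ : ∀ {x} {X : Set x} (s : X → Exp) o → out id (mapᵒ s o) ≡ out s o
  out-mapᵒ s reject     = refl
  out-mapᵒ s accept     = refl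
  out-mapᵒ s (step p x) = refl

  match-mapᵒ⁺ : ∀ {x} {X : Set x} {s : X → Exp} o {u} → Match id (mapᵒ s o) u → Match s o u
  match-mapᵒ⁺ accept     done     = done
  match-mapᵒ⁺ (step p x) (next l) = next l

  match-mapᵒ⁻ : ∀ {x} {X : Set x} {s : X → Exp} {o u} → Match s o u → Match id (mapᵒ s o) u
  match-mapᵒ⁻ done     = done
  match-mapᵒ⁻ (next l) = next l

  restrict : ∀ xs (o : Outcome Exp) → (∀ {f} → f ∈ᵒ o → f ∈ xs) → ∃ λ o′ → mapᵒ (lookup xs) o′ ≡ o
  restrict xs reject     _   = reject , refl
  restrict xs accept     _   = accept , refl
  restrict xs (step p e) f∈ = step p (index (f∈ target)) , cong (step p) (≡.sym (lookup-index (f∈ target)))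

  closed-recognizer : ∀ xs → Closed xs → ∃ (Recognizes (lookup xs))
  closed-recognizer xs closed = (λ i v → proj₁ (δ i v)) , record
    { unfold = λ i v → trans (⊢-derivative (lookup xs i) v)
        (reflexive (cong (test (atom v) ⨾_)
          (≡.trans (cong (out id) (≡.sym (proj₂ (δ i v)))) (out-mapᵒ _ (proj₁ (δ i v))))))
    ; word⁺ = λ i v α {u} v⊩α l → match-mapᵒ⁺ (proj₁ (δ i v))
        (subst (λ o → Match id o u) (≡.sym (proj₂ (δ i v))) (derivative-⟦⟧⁺ (lookup xs i) α v⊩α l))
    ; word⁻ = λ i v α {u} v⊩α m → derivative-⟦⟧⁻ (lookup xs i) α v⊩α
        (subst (λ o → Match id o u) (proj₂ (δ i v)) (match-mapᵒ⁻ m))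
    }
    where
    δ : ∀ i v → ∃ λ o → mapᵒ (lookup xs) o ≡ derivative (lookup xs i) v
    δ i v = restrict xs (derivative (lookup xs i) v) (closed (∈-lookup i) v)

  -- Salomaa systems of automata

  summand : Exp × BExp × Exp → Exp → Exp
  summand (e , b , x) r = e ⨾ x +⟨ b ⟩ r

  ⊢-foldr-none : ∀ v {m} (ρ : Vector (Exp × BExp × Exp) m) d →
                 (∀ j → eval (proj₁ (proj₂ (ρ j))) v ≡ false) → v ⊢ foldr summand d ρ ≈ d
  ⊢-foldr-none v {zero}  ρ d p = refl
  ⊢-foldr-none v {suc m} ρ d p =
    trans (⊢-guard v _ _ _)
   (trans (reflexive (cong (λ y → test (atom v) ⨾ (if y then _ else _)) (p zero)))
          (⊢-foldr-none v (ρ ∘ suc) d (p ∘ suc)))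

  ⊢-foldr-one : ∀ v {m} (ρ : Vector (Exp × BExp × Exp) m) d j →
                eval (proj₁ (proj₂ (ρ j))) v ≡ true →
                (∀ i → i ≢ j → eval (proj₁ (proj₂ (ρ i))) v ≡ false) →
                v ⊢ foldr summand d ρ ≈ proj₁ (ρ j) ⨾ proj₂ (proj₂ (ρ j))
  ⊢-foldr-one v ρ d zero p q =
    trans (⊢-guard v _ _ _) (reflexive (cong (λ y → test (atom v) ⨾ (if y then _ else _)) p))
  ⊢-foldr-one v ρ d (suc j) p q =
    trans (⊢-guard v _ _ _)
   (trans (reflexive (cong (λ y → test (atom v) ⨾ (if y then _ else _)) (q zero λ ())))
          (⊢-foldr-one v (ρ ∘ suc) d j p λ i i≢j → q (suc i) (i≢j ∘ Fin.suc-injective)))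

  module _ {n} (δ : Fin n → Valuation → Outcome (Fin n)) where
    private
      letter : Outcome (Fin n) → Exp
      letter (step p _) = act p
      letter _          = test 𝟘

      leads : Outcome (Fin n) → Fin n → Bool
      leads (step p i) j = does (i Fin.≟ j)
      leads _          j = false

      leads-unique : ∀ o {j k} → j ≢ k → leads o j ∧ leads o k ≡ false
      leads-unique reject     j≢k = refl
      leads-unique accept     j≢k = refl
      leads-unique (step p i) {j} {k} j≢k with i Fin.≟ j | i Fin.≟ k
      ... | yes refl | yes refl = contradiction refl j≢k
      ... | yes _    | no _     = refl
      ... | no _     | _        = refl

      leads-isAccept : ∀ o j → leads o j ∧ isAccept o ≡ false
      leads-isAccept reject     j = refl
      leads-isAccept accept     j = refl
      leads-isAccept (step p i) j = Bool.∧-zeroʳ _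

      eval-E-letter : ∀ o v → eval (E (letter o)) v ≡ false
      eval-E-letter reject     v = refl
      eval-E-letter accept     v = refl
      eval-E-letter (step p i) v = refl

    -- All coefficients of a row coincide: the guards alone select the target.
    system : System n
    system = record
      { coeff = λ i _ → sum (letter ∘ δ i)
      ; guard = λ i j → holds λ v → leads (δ i v) j
      ; const = λ i → holds (isAccept ∘ δ i)
      ; guard-disjoint = λ i j≢k → eval-ext λ v →
          ≡.trans (cong₂ _∧_ (eval-holds _ v) (eval-holds _ v)) (leads-unique (δ i v) j≢k)
      ; const-disjoint = λ i j → eval-ext λ v →
          ≡.trans (cong₂ _∧_ (eval-holds _ v) (eval-holds _ v)) (leads-isAccept (δ i v) j)
      }

    system-salomaa : IsSalomaa _≈_ system
    system-salomaa i j = test-BA (eval-ext λ v →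
      ≡.trans (eval-E-sum v (letter ∘ δ i)) (eval-E-letter (δ i v) v))

    -- At one atom at most one guard of the row is true, so the row collapses to the summand of the
    -- target or to the constant.
    ⊢-rhs : ∀ s i v → v ⊢ System.rhs system s i ≈ out s (δ i v)
    ⊢-rhs s i v = lemma (δ i v) refl
      where
      row : Vector (Exp × BExp × Exp) n
      row j = System.coeff system i j , System.guard system i j , s j
      d = test (System.const system i)
      eval-guard : ∀ {o} → δ i v ≡ o → ∀ j → eval (System.guard system i j) v ≡ leads o j
      eval-guard eq j = ≡.trans (eval-holds _ v) (cong (λ o → leads o j) eq)
      ⊢-const : ∀ {o} → δ i v ≡ o → v ⊢ d ≈ test (if isAccept o then 𝟙 else 𝟘)
      ⊢-const eq = trans (⊢-test v (System.const system i))
        (reflexive (cong (λ y → test (atom v) ⨾ test (if y then 𝟙 else 𝟘))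
          (≡.trans (eval-holds _ v) (cong isAccept eq))))
      lemma : ∀ o → δ i v ≡ o → v ⊢ foldr summand d row ≈ out s o
      lemma reject eq = trans (⊢-foldr-none v row d (eval-guard eq)) (⊢-const eq)
      lemma accept eq = trans (⊢-foldr-none v row d (eval-guard eq)) (⊢-const eq)
      lemma (step p j) eq =
        trans (⊢-foldr-one v row d j
                (≡.trans (eval-guard eq j) (dec-true (j Fin.≟ j) refl))
                (λ k k≢j → ≡.trans (eval-guard eq k) (dec-false (j Fin.≟ k) (k≢j ∘ ≡.sym))))
              (⊢-⨾-congˡ (s j) (trans (⊢-sum v (letter ∘ δ i))
                (reflexive (cong (λ o → test (atom v) ⨾ letter o) eq))))

    solution-unique : ∀ {s s′} → (∀ i v → v ⊢ s i ≈ out s (δ i v)) →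
                      (∀ i v → v ⊢ s′ i ≈ out s′ (δ i v)) → ∀ i → s i ≈ s′ i
    solution-unique p p′ = unique system system-salomaa (solves p) (solves p′)
      where
      solves : ∀ {s} → (∀ i v → v ⊢ s i ≈ out s (δ i v)) → IsSolution _≈_ system s
      solves {s} p i = ⊢-ext λ v → trans (p i v) (sym (⊢-rhs s i v))

  module _ {n} (δ : Fin n → Valuation → Outcome (Fin n)) {ℓ} {P : Pred (Fin n) ℓ} (P? : Decidable P)
           (P-closed : ∀ {i j v} → P i → j ∈ᵒ δ i v → P j) where
    -- States outside P are made to reject, so that both candidates can be 0 there.
    private
      δ′ : Fin n → Valuation → Outcome (Fin n)
      δ′ i v = if does (P? i) then δ i v else reject

      extendByZero : (Fin n → Exp) → Fin n → Exp
      extendByZero s i = if does (P? i) then s i else test 𝟘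

      extendByZero-∈ : ∀ s {i} → P i → extendByZero s i ≡ s i
      extendByZero-∈ s {i} Pi rewrite dec-true (P? i) Pi = refl

      out-extendByZero : ∀ s o → (∀ {j} → j ∈ᵒ o → P j) → out s o ≡ out (extendByZero s) o
      out-extendByZero s reject     Po = refl
      out-extendByZero s accept     Po = refl
      out-extendByZero s (step p j) Po = cong (act p ⨾_) (≡.sym (extendByZero-∈ s (Po target)))

      extendByZero-solves : ∀ {s} → (∀ i v → P i → v ⊢ s i ≈ out s (δ i v)) →
                            ∀ i v → v ⊢ extendByZero s i ≈ out (extendByZero s) (δ′ i v)
      extendByZero-solves {s} p i v with P? i
      ... | yes Pi = trans (p i v Pi)
                           (reflexive (cong (test (atom v) ⨾_) (out-extendByZero s (δ i v) (P-closed Pi))))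
      ... | no _   = refl

    solution-unique-on : ∀ {s s′} → (∀ i v → P i → v ⊢ s i ≈ out s (δ i v)) →
                         (∀ i v → P i → v ⊢ s′ i ≈ out s′ (δ i v)) → ∀ i → P i → s i ≈ s′ i
    solution-unique-on {s} {s′} p p′ i Pi =
      trans (reflexive (≡.sym (extendByZero-∈ s Pi)))
     (trans (solution-unique δ′ (extendByZero-solves p) (extendByZero-solves p′) i)
            (reflexive (extendByZero-∈ s′ Pi)))

  -- Live states and pruning

  Edge : ∀ {n} → (Fin n → Valuation → Outcome (Fin n)) → Rel (Fin n) a
  Edge δ i j = ∃ λ v → j ∈ᵒ δ i v

  _∈ᵒ?_ : ∀ {n} (j : Fin n) o → Dec (j ∈ᵒ o)
  j ∈ᵒ? reject   = no λ ()
  j ∈ᵒ? accept   = no λ ()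
  j ∈ᵒ? step p i = Dec.map′ (λ { refl → target }) (λ { target → refl }) (i Fin.≟ j)

  path? : ∀ {n} (δ : Fin n → Valuation → Outcome (Fin n)) → Binary.Decidable (Star (Edge δ))
  path? δ = star? λ i j → anySubset? λ v → j ∈ᵒ? δ i v

  accept? : ∀ {x} {X : Set x} (o : Outcome X) → Dec (o ≡ accept)
  accept? reject     = no λ ()
  accept? accept     = yes refl
  accept? (step _ _) = no λ ()

  -- A decidable substitute for having a nonempty language, with which it agrees by `live⇒word` and
  -- `dead⇒no-word`.
  Live : ∀ {n} → (Fin n → Valuation → Outcome (Fin n)) → Pred (Fin n) a
  Live δ i = ∃ λ j → Star (Edge δ) i j × ∃ λ v → δ j v ≡ accept

  live? : ∀ {n} (δ : Fin n → Valuation → Outcome (Fin n)) → Decidable (Live δ)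
  live? δ i = Fin.any? λ j → path? δ i j ×-dec anySubset? λ v → accept? (δ j v)

  module _ {n} {s : Fin n → Exp} {δ : Fin n → Valuation → Outcome (Fin n)} (rec : Recognizes s δ) where

    live⇒word : ∀ {i} → Live δ i → ∃ ⟦ s i ⟧
    live⇒word (_ , path , v , eq) = word-along path
      where
      word-along : ∀ {i} → Star (Edge δ) i _ → ∃ ⟦ s i ⟧
      word-along ε =
        (toAt v , []) , word⁻ rec _ v (toAt v) refl (subst (λ o → Match s o []) (≡.sym eq) done)
      word-along {i} ((w , h∈) ◅ path) with (β , u) , l ← word-along path | δ i w in eq′
      word-along {i} ((w , target {p}) ◅ path) | step _ h =
        (toAt w , (p , β) ∷ u) ,
        word⁻ rec i w (toAt w) refl (subst (λ o → Match s o ((p , β) ∷ u)) (≡.sym eq′) (next l))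

    private
      dead-step : ∀ {i j v} → ¬ Live δ i → j ∈ᵒ δ i v → ¬ Live δ j
      dead-step {v = v} dead j∈ (h , path , accepting) = dead (h , (v , j∈) ◅ path , accepting)

    dead⇒no-word : ∀ {i} → ¬ Live δ i → ∀ α u → ¬ ⟦ s i ⟧ (α , u)
    dead⇒no-word {i} dead α u l with v , v⊩α ← valuation α = lemma (δ i v) u refl (word⁺ rec i v α v⊩α l)
      where
      lemma : ∀ o u → δ i v ≡ o → ¬ Match s o u
      lemma _ _ eq done = dead (i , ε , v , eq)
      lemma (step p j) ((_ , β) ∷ u) eq (next l) =
        dead⇒no-word (dead-step dead (subst (j ∈ᵒ_) (≡.sym eq) target)) β u l

    dead⇒𝟘 : ∀ {i} → ¬ Live δ i → s i ≈ test 𝟘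
    dead⇒𝟘 {i} = solution-unique-on δ (λ i → ¬? (live? δ i)) dead-step
                   (λ i v _ → unfold rec i v) zero-solves i
      where
      zero-solves : ∀ i v → ¬ Live δ i → v ⊢ test 𝟘 ≈ out (λ _ → test 𝟘) (δ i v)
      zero-solves i v dead with δ i v in eq
      ... | reject   = refl
      ... | accept   = contradiction (i , ε , v , eq) dead
      ... | step p j = ⊢-cong (sym (S3 (act p)))

    private
      prune : Outcome (Fin n) → Outcome (Fin n)
      prune (step p j) = if does (live? δ j) then step p j else reject
      prune o          = o

      out-prune : ∀ o → out s o ≈ out s (prune o)
      out-prune reject = refl
      out-prune accept = refl
      out-prune (step p j) with live? δ j
      ... | yes _   = refl
      ... | no dead = trans (⨾-cong refl (dead⇒𝟘 dead)) (S3 (act p))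

      match-prune⁺ : ∀ {o u} → Match s o u → Match s (prune o) u
      match-prune⁺ done = done
      match-prune⁺ (next {x = j} {β} {u} l) with live? δ j
      ... | yes _   = next l
      ... | no dead = contradiction l (dead⇒no-word dead β u)

      match-prune⁻ : ∀ o {u} → Match s (prune o) u → Match s o u
      match-prune⁻ accept m = m
      match-prune⁻ (step p j) m with live? δ j
      ... | yes _ = m

      prune-live : ∀ o {j} → j ∈ᵒ prune o → Live δ j
      prune-live (step p i) j∈ with live? δ i
      prune-live (step p i) target | yes live = live

    pruned : ∃ λ δ′ → Recognizes s δ′ × (∀ {i v j} → j ∈ᵒ δ′ i v → ∃ ⟦ s j ⟧)
    pruned = (λ i v → prune (δ i v)) , record
      { unfold = λ i v → trans (unfold rec i v) (⊢-cong (out-prune (δ i v)))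
      ; word⁺  = λ i v α v⊩α l → match-prune⁺ (word⁺ rec i v α v⊩α l)
      ; word⁻  = λ i v α v⊩α m → word⁻ rec i v α v⊩α (match-prune⁻ (δ i v) m)
      } , λ {i} {v} j∈ → live⇒word (prune-live (δ i v) j∈)

  -- Pairs of states with the same language

  module _ {n} {s : Fin n → Exp} {δ : Fin n → Valuation → Outcome (Fin n)} (rec : Recognizes s δ)
           (inhabited : ∀ {i v j} → j ∈ᵒ δ i v → ∃ ⟦ s j ⟧) where
    private
      infix 4 _~~_
      _~~_ : Rel (Fin n) _
      i ~~ j = ∀ α u → (⟦ s i ⟧ (α , u) → ⟦ s j ⟧ (α , u)) × (⟦ s j ⟧ (α , u) → ⟦ s i ⟧ (α , u))

    data Bisimilar : Rel (Outcome (Fin n)) (a ⊔ t) where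
      reject : Bisimilar reject reject
      accept : Bisimilar accept accept
      step   : ∀ {p i j} → i ~~ j → Bisimilar (step p i) (step p j)

    -- A word of the target makes a step visible: it rules out `reject` on the other side and forces
    -- both actions to agree. Stripping the common action then compares the targets.
    match⇒bisimilar : ∀ o o′ → (∀ {j} → j ∈ᵒ o → ∃ ⟦ s j ⟧) → (∀ {j} → j ∈ᵒ o′ → ∃ ⟦ s j ⟧) →
                      (∀ u → Match s o u → Match s o′ u) → (∀ u → Match s o′ u → Match s o u) →
                      Bisimilar o o′
    match⇒bisimilar reject reject _ _ _ _ = reject
    match⇒bisimilar accept accept _ _ _ _ = accept
    match⇒bisimilar reject accept _ _ _ g with () ← g [] done
    match⇒bisimilar accept reject _ _ f _ with () ← f [] done
    match⇒bisimilar accept (step _ _) _ _ f _ with () ← f [] done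
    match⇒bisimilar (step _ _) accept _ _ _ g with () ← g [] done
    match⇒bisimilar reject (step p j) _ inh′ _ g with (β , u) , l ← inh′ target
      with () ← g ((p , β) ∷ u) (next l)
    match⇒bisimilar (step p i) reject inh _ f _ with (β , u) , l ← inh target
      with () ← f ((p , β) ∷ u) (next l)
    match⇒bisimilar (step p i) (step q j) inh _ f g
      with (β , u) , l ← inh target with f ((p , β) ∷ u) (next l)
    ... | next _ = step λ α w → unnext ∘ f ((p , α) ∷ w) ∘ next , unnext ∘ g ((p , α) ∷ w) ∘ next
      where
      unnext : ∀ {p q h α w} → Match s (step p h) ((q , α) ∷ w) → ⟦ s h ⟧ (α , w)
      unnext (next l) = l

    ~~⇒bisimilar : ∀ {i j} → i ~~ j → ∀ v → Bisimilar (δ i v) (δ j v)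
    ~~⇒bisimilar {i} {j} i~j v = match⇒bisimilar (δ i v) (δ j v) inhabited inhabited
      (λ u m → word⁺ rec j v (toAt v) refl (proj₁ (i~j (toAt v) u) (word⁻ rec i v (toAt v) refl m)))
      (λ u m → word⁺ rec i v (toAt v) refl (proj₂ (i~j (toAt v) u) (word⁻ rec j v (toAt v) refl m)))

    private
      left right : Fin (n * n) → Fin n
      left  = proj₁ ∘ remQuot {n} n
      right = proj₂ ∘ remQuot {n} n

      pair : Fin n → Fin n → Fin (n * n)
      pair = combine

      left-combine : ∀ i j → left (pair i j) ≡ i
      left-combine i j = cong proj₁ (Fin.remQuot-combine {n} i j)

      right-combine : ∀ i j → right (pair i j) ≡ j
      right-combine i j = cong proj₂ (Fin.remQuot-combine {n} i j)

      ~~-combine : ∀ {i j} → i ~~ j → left (pair i j) ~~ right (pair i j)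
      ~~-combine {i} {j} = subst₂ _~~_ (≡.sym (left-combine i j)) (≡.sym (right-combine i j))

      -- Only bisimilar outcomes matter; on all others the value is arbitrary, including the choice
      -- of p when the actions differ.
      zip : Outcome (Fin n) → Outcome (Fin n) → Outcome (Fin (n * n))
      zip accept     accept     = accept
      zip (step p i) (step q j) = step p (pair i j)
      zip _          _          = reject

      δ² : Fin (n * n) → Valuation → Outcome (Fin (n * n))
      δ² x v = zip (δ (left x) v) (δ (right x) v)

      out-zipˡ : ∀ {o o′} → Bisimilar o o′ → out s o ≡ out (s ∘ left) (zip o o′)
      out-zipˡ reject = refl
      out-zipˡ accept = refl
      out-zipˡ (step {p} {i} {j} _) = cong (λ h → act p ⨾ s h) (≡.sym (left-combine i j))

      out-zipʳ : ∀ {o o′} → Bisimilar o o′ → out s o′ ≡ out (s ∘ right) (zip o o′)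
      out-zipʳ reject = refl
      out-zipʳ accept = refl
      out-zipʳ (step {p} {i} {j} _) = cong (λ h → act p ⨾ s h) (≡.sym (right-combine i j))

      ∈ᵒ-zip : ∀ {o o′ x} → Bisimilar o o′ → x ∈ᵒ zip o o′ → left x ~~ right x
      ∈ᵒ-zip (step i~j) target = ~~-combine i~j

      path-~~ : ∀ {x y} → Star (Edge δ²) x y → left x ~~ right x → left y ~~ right y
      path-~~ ε x~ = x~
      path-~~ ((v , z∈) ◅ path) x~ = path-~~ path (∈ᵒ-zip (~~⇒bisimilar x~ v) z∈)

    -- Uniqueness is applied on the pairs reachable from x, since `solution-unique-on` asks for a
    -- decidable set; `path-~~` carries equality of languages along the paths.
    equal-languages⇒≈ : ∀ i j → i ~~ j → s i ≈ s j
    equal-languages⇒≈ i j i~j = subst₂ (λ i j → s i ≈ s j) (left-combine i j) (right-combine i j)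
      (solution-unique-on δ² (path? δ² x) (λ {_} {_} {v} path z∈ → path ◅◅ (v , z∈) ◅ ε)
        (λ y v path → trans (unfold rec (left y) v)
          (reflexive (cong (test (atom v) ⨾_) (out-zipˡ (~~⇒bisimilar (path-~~ path x~) v)))))
        (λ y v path → trans (unfold rec (right y) v)
          (reflexive (cong (test (atom v) ⨾_) (out-zipʳ (~~⇒bisimilar (path-~~ path x~) v)))))
        x ε)
      where
      x = pair i j
      x~ : left x ~~ right x
      x~ = ~~-combine i~j

  completeness : ∀ e f → ⟦ e ⟧ ≐ ⟦ f ⟧ → e ≈ f
  completeness e f (e⊆f , f⊆e) = subst₂ _≈_ (≡.sym (lookup-index e∈)) (≡.sym (lookup-index f∈))
    (equal-languages⇒≈ (proj₁ (proj₂ trim)) (proj₂ (proj₂ trim)) (index e∈) (index f∈)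
      (subst₂ (λ e f → ∀ α u → (⟦ e ⟧ (α , u) → ⟦ f ⟧ (α , u)) × (⟦ f ⟧ (α , u) → ⟦ e ⟧ (α , u)))
        (lookup-index e∈) (lookup-index f∈) (λ α u → e⊆f , f⊆e)))
    where
    -- One automaton contains both expressions, so that they are compared as two of its states.
    xs = derivatives e ++ derivatives f
    e∈ : e ∈ xs
    e∈ = ∈-++⁺ˡ (self∈derivatives e)
    f∈ : f ∈ xs
    f∈ = ∈-++⁺ʳ (derivatives e) (self∈derivatives f)
    trim = pruned (proj₂ (closed-recognizer xs (++-closed (derivatives-closed e) (derivatives-closed f))))

theorem6p3 : ∀ {a t} (Act : Set a) (T : Set t) → Act → T → ∃[ k ] (T ↔ Fin k) →
    let open GKAT Act T in
    ∀ (e₁ e₂ : Exp) → ⟦ e₁ ⟧ ≐ ⟦ e₂ ⟧ → e₁ ≈ e₂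
theorem6p3 Act T _ _ (k , T↔Fin) = Completeness.completeness Act T T↔Fin
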